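{- Strong barbed similarity $\overset{\bullet}{\leq}_B$ on processes of the $\pi$-calculus has the following properties: 1. it is a preorder (reflexive and transitive); 2. it is preserved by input prefix, output prefix and restriction: if $P\ \overset{\bullet}{\leq}_B\ Q$, then for all names $x,y$: $x(y).P\ \overset{\bullet}{\leq}_B\ x(y).Q$, $\ \bar xy.P\ \overset{\bullet}{\leq}_B\ \bar xy.Q$, and $(\nu x)P\ \overset{\bullet}{\leq}_B\ (\nu x)Q$; 3. it includes structural congruence: if $P\equiv Q$ then $P\ \overset{\bullet}{\leq}_B\ Q$.
   Context: Syntax. Over an infinite set of names, processes are $P,Q ::= \mathbf 0 \mid x(y).P \mid \bar x y.P \mid (P\mid Q) \mid (\nu x)P \mid\ !P$. Input $x(y).P$ and restriction $(\nu y)P$ bind $y$ in $P$; all other name occurrences are free; processes are identified up to $\alpha$-equivalence; $\mathrm{fn}(P)$ is the set of free names. Actions: $\alpha ::= x(y)\mid \bar x y\mid \bar x(y)\mid\tau$ (input, free output, bound output, internal). In $x(y)$ and $\bar x(y)$ the name $y$ is bound; other occurrences are free. $\mathrm{fn}(\alpha),\mathrm{bn}(\alpha),\mathrm n(\alpha)$ denote free, bound, all names. Convention: in a transition $P\xrightarrow{\alpha}P'$ the bound name of $\alpha$ (if any) is fresh, i.e. $\mathrm{bn}(\alpha)\cap\mathrm{fn}(P)=\emptyset$; it may occur free in $P'$ and is regarded as binding there. Late labelled transition system (least relations closed under): S-In: $x(z).P\xrightarrow{x(z)}P$. S-Out: $\bar xy.P\xrightarrow{\bar xy}P$. S-Par-L: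 if $P\xrightarrow{\alpha}P'$ and $\mathrm{bn}(\alpha)\cap\mathrm{fn}(Q)=\emptyset$ then $P\mid Q\xrightarrow{\alpha}P'\mid Q$; S-Par-R: symmetric. S-Com-L: if $P\xrightarrow{\bar xy}P'$ and $Q\xrightarrow{x(z)}Q'$ then $P\mid Q\xrightarrow{\tau}P'\mid Q'\{y/z\}$; S-Com-R: symmetric. S-Res: if $P\xrightarrow{\alpha}P'$ and $z\notin\mathrm n(\alpha)$ then $(\nu z)P\xrightarrow{\alpha}(\nu z)P'$. S-Open: if $P\xrightarrow{\bar xz}P'$ and $z\ne x$ then $(\nu z)P\xrightarrow{\bar x(z)}P'$. S-Close-L: if $P\xrightarrow{\bar x(z)}P'$ and $Q\xrightarrow{x(z)}Q'$ then $P\mid Q\xrightarrow{\tau}(\nu z)(P'\mid Q')$; S-Close-R: symmetric. S-Rep: if $P\xrightarrow{\alpha}P'$ then $!P\xrightarrow{\alpha}P'\mid !P$. S-Rep-Com: if $P\xrightarrow{\bar xy}P'$ and $P\xrightarrow{x(z)}P''$ then $!P\xrightarrow{\tau}(P'\mid P''\{y/z\})\mid !P$. S-Rep-Close: if $P\xrightarrow{\bar x(z)}P'$ and $P\xrightarrow{x(z)}P''$ then $!P\xrightarrow{\tau}((\nu z)(P'\mid P''))\mid !P$. Structural congruence $\equiv$ is the smallest equivalence relation on processes that is preserved by all constructors ($P\equiv Q$ implies $x(y).P\equiv x(y).Q$, $\bar xy.P\equiv\bar xy.Q$, $(\nu x)P\equiv(\nu x)Q$, $!P\equiv !Q$; and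 $P\equiv P',Q\equiv Q'$ imply $P\mid Q\equiv P'\mid Q'$) and satisfies $P\mid(Q\mid R)\equiv(P\mid Q)\mid R$; $P\mid\mathbf 0\equiv P$; $P\mid Q\equiv Q\mid P$; $(\nu x)\mathbf 0\equiv\mathbf 0$; $(\nu x)P\mid Q\equiv(\nu x)(P\mid Q)$ if $x\notin\mathrm{fn}(Q)$; $(\nu x)(\nu y)P\equiv(\nu y)(\nu x)P$; $!P\equiv P\mid !P$. Barbs: $P\downarrow_x$ iff $P\xrightarrow{x(z)}P'$ for some $z,P'$; $P\downarrow_{\bar x}$ iff $P\xrightarrow{\bar xy}P'$ or $P\xrightarrow{\bar x(z)}P'$ for some $y,z,P'$. A strong barbed simulation is a binary relation $\mathcal R$ on processes such that whenever $P\mathbin{\mathcal R}Q$: (1) $P\downarrow_x$ implies $Q\downarrow_x$ and $P\downarrow_{\bar x}$ implies $Q\downarrow_{\bar x}$, for all names $x$; (2) if $P\xrightarrow{\tau}P'$ then there is $Q'$ with $Q\xrightarrow{\tau}Q'$ and $P'\mathbin{\mathcal R}Q'$. Strong barbed similarity $\overset{\bullet}{\leq}_B$ is the union of all strong barbed simulations. -}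

module Defs where

open import Level using (0ℓ) renaming (suc to lsuc)
open import Data.Bool using (if_then_else_)
open import Data.Fin using (Fin; fromℕ; inject₁)
open import Data.List using (List; []; _∷_; _++_)
open import Data.List.Membership.Propositional using (_∈_; _∉_)
open import Data.Nat using (ℕ; zero; suc)
open import Data.Product using (Σ; _×_; ∃-syntax; ∃₂)
open import Data.Sum using (_⊎_)
open import Relation.Binary.Core using (Rel)
open import Relation.Binary.Definitions using (DecidableEquality)
open import Relation.Binary.PropositionalEquality using (_≡_; _≢_)
open import Relation.Nullary using (does)

-- An infinite set of names: equality is decidable and no finite list
-- exhausts it.
record Names : Set₁ where
  infix 4 _≟_
  field
    Name  : Set
    _≟_   : DecidableEquality Name
    fresh : (xs : List Name) → ∃[ x ] x ∉ xs

module π-Calculus (𝒩 : Names) where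

  open Names 𝒩 public

  infixr 7 _⦅_⦆∙_ _⟨_⟩∙_
  infixr 7 ν[_]_
  infix  7 !_
  infixr 6 _∣_
  infix  8 _⦅_⦆ _⟨_⟩ _⟨ν_⟩
  infix  4 _—[_]→_ _≅_ _↓_ _↓̄_ _≤B_

  -- Locally nameless representation: free names are names, bound names are
  -- de Bruijn indices (the innermost binder is index zero), so that
  -- α-equivalence is propositional equality.  Proc n allows n dangling
  -- indices; processes are the terms with none.

  data Ref (n : ℕ) : Set where
    name : Name → Ref n
    idx  : Fin n → Ref n

  data Proc (n : ℕ) : Set where
    𝟎   : Proc n
    inp : Ref n → Proc (suc n) → Proc n
    out : Ref n → Ref n → Proc n → Proc n
    _∣_ : Proc n → Proc n → Proc n
    res : Proc (suc n) → Proc n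
    !_  : Proc n → Proc n

  Process : Set
  Process = Proc zero

  -- abs x P turns the free occurrences of x into references to a new
  -- binder placed outside P.  The new binder is the outermost one, hence
  -- has the largest index, and the existing indices are unchanged.

  absRef : ∀ {n} → Name → Ref n → Ref (suc n)
  absRef {n} x (name y) = if does (x ≟ y) then idx (fromℕ n) else name y
  absRef     x (idx i)  = idx (inject₁ i)

  abs : ∀ {n} → Name → Proc n → Proc (suc n)
  abs x 𝟎           = 𝟎
  abs x (inp a P)   = inp (absRef x a) (abs x P)
  abs x (out a b P) = out (absRef x a) (absRef x b) (abs x P)
  abs x (P ∣ Q)     = abs x P ∣ abs x Q
  abs x (res P)     = res (abs x P)
  abs x (! P)       = ! abs x P

  _⦅_⦆∙_ : Name → Name → Process → Process
  x ⦅ y ⦆∙ P = inp (name x) (abs y P)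

  _⟨_⟩∙_ : Name → Name → Process → Process
  x ⟨ y ⟩∙ P = out (name x) (name y) P

  ν[_]_ : Name → Process → Process
  ν[ x ] P = res (abs x P)

  fnRef : ∀ {n} → Ref n → List Name
  fnRef (name x) = x ∷ []
  fnRef (idx i)  = []

  fn : ∀ {n} → Proc n → List Name
  fn 𝟎           = []
  fn (inp a P)   = fnRef a ++ fn P
  fn (out a b P) = fnRef a ++ fnRef b ++ fn P
  fn (P ∣ Q)     = fn P ++ fn Q
  fn (res P)     = fn P
  fn (! P)       = fn P

  -- P [ y / z ] is P{y/z}.  It is capture-avoiding, since binders carry no
  -- names.

  substRef : ∀ {n} → Name → Name → Ref n → Ref n
  substRef y z (name x) = if does (z ≟ x) then name y else name x
  substRef y z (idx i)  = idx i

  _[_/_] : ∀ {n} → Proc n → Name → Name → Proc n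
  𝟎         [ y / z ] = 𝟎
  inp a P   [ y / z ] = inp (substRef y z a) (P [ y / z ])
  out a b P [ y / z ] = out (substRef y z a) (substRef y z b) (P [ y / z ])
  (P ∣ Q)   [ y / z ] = (P [ y / z ]) ∣ (Q [ y / z ])
  res P     [ y / z ] = res (P [ y / z ])
  (! P)     [ y / z ] = ! (P [ y / z ])

  data Action : Set where
    _⦅_⦆  : Name → Name → Action
    _⟨_⟩  : Name → Name → Action
    _⟨ν_⟩ : Name → Name → Action
    τ     : Action

  bn : Action → List Name
  bn (x ⦅ y ⦆)  = y ∷ []
  bn (x ⟨ y ⟩)  = []
  bn (x ⟨ν y ⟩) = y ∷ []
  bn τ          = []

  n⟦_⟧ : Action → List Name
  n⟦ x ⦅ y ⦆ ⟧  = x ∷ y ∷ []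
  n⟦ x ⟨ y ⟩ ⟧  = x ∷ y ∷ []
  n⟦ x ⟨ν y ⟩ ⟧ = x ∷ y ∷ []
  n⟦ τ ⟧        = []

  -- The convention that bn(α) is disjoint from fn(P) in every transition
  -- P —[ α ]→ P′ is imposed by the premise of S-In; all the other rules
  -- preserve it.

  data _—[_]→_ : Process → Action → Process → Set where

    S-In : ∀ {x z P} →
      z ∉ fn (x ⦅ z ⦆∙ P) →
      x ⦅ z ⦆∙ P —[ x ⦅ z ⦆ ]→ P

    S-Out : ∀ {x y P} →
      x ⟨ y ⟩∙ P —[ x ⟨ y ⟩ ]→ P

    S-Par-L : ∀ {α P P′ Q} →
      P —[ α ]→ P′ →
      (∀ {z} → z ∈ bn α → z ∉ fn Q) →
      P ∣ Q —[ α ]→ P′ ∣ Q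

    S-Par-R : ∀ {α P Q Q′} →
      Q —[ α ]→ Q′ →
      (∀ {z} → z ∈ bn α → z ∉ fn P) →
      P ∣ Q —[ α ]→ P ∣ Q′

    S-Com-L : ∀ {x y z P P′ Q Q′} →
      P —[ x ⟨ y ⟩ ]→ P′ →
      Q —[ x ⦅ z ⦆ ]→ Q′ →
      P ∣ Q —[ τ ]→ P′ ∣ (Q′ [ y / z ])

    S-Com-R : ∀ {x y z P P′ Q Q′} →
      P —[ x ⦅ z ⦆ ]→ P′ →
      Q —[ x ⟨ y ⟩ ]→ Q′ →
      P ∣ Q —[ τ ]→ (P′ [ y / z ]) ∣ Q′

    S-Res : ∀ {α z P P′} →
      P —[ α ]→ P′ →
      z ∉ n⟦ α ⟧ →
      ν[ z ] P —[ α ]→ ν[ z ] P′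

    S-Open : ∀ {x z P P′} →
      P —[ x ⟨ z ⟩ ]→ P′ →
      z ≢ x →
      ν[ z ] P —[ x ⟨ν z ⟩ ]→ P′

    S-Close-L : ∀ {x z P P′ Q Q′} →
      P —[ x ⟨ν z ⟩ ]→ P′ →
      Q —[ x ⦅ z ⦆ ]→ Q′ →
      P ∣ Q —[ τ ]→ ν[ z ] (P′ ∣ Q′)

    S-Close-R : ∀ {x z P P′ Q Q′} →
      P —[ x ⦅ z ⦆ ]→ P′ →
      Q —[ x ⟨ν z ⟩ ]→ Q′ →
      P ∣ Q —[ τ ]→ ν[ z ] (P′ ∣ Q′)

    S-Rep : ∀ {α P P′} →
      P —[ α ]→ P′ →
      ! P —[ α ]→ P′ ∣ ! P

    S-Rep-Com : ∀ {x y z P P′ P″} →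
      P —[ x ⟨ y ⟩ ]→ P′ →
      P —[ x ⦅ z ⦆ ]→ P″ →
      ! P —[ τ ]→ (P′ ∣ (P″ [ y / z ])) ∣ ! P

    S-Rep-Close : ∀ {x z P P′ P″} →
      P —[ x ⟨ν z ⟩ ]→ P′ →
      P —[ x ⦅ z ⦆ ]→ P″ →
      ! P —[ τ ]→ (ν[ z ] (P′ ∣ P″)) ∣ ! P

  data _≅_ : Process → Process → Set where

    ≅-refl  : ∀ {P} → P ≅ P
    ≅-sym   : ∀ {P Q} → P ≅ Q → Q ≅ P
    ≅-trans : ∀ {P Q R} → P ≅ Q → Q ≅ R → P ≅ R

    in-cong  : ∀ {x y P Q} → P ≅ Q → x ⦅ y ⦆∙ P ≅ x ⦅ y ⦆∙ Q
    out-cong : ∀ {x y P Q} → P ≅ Q → x ⟨ y ⟩∙ P ≅ x ⟨ y ⟩∙ Q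
    par-cong : ∀ {P P′ Q Q′} → P ≅ P′ → Q ≅ Q′ → P ∣ Q ≅ P′ ∣ Q′
    res-cong : ∀ {x P Q} → P ≅ Q → ν[ x ] P ≅ ν[ x ] Q
    rep-cong : ∀ {P Q} → P ≅ Q → ! P ≅ ! Q

    par-assoc : ∀ {P Q R} → P ∣ (Q ∣ R) ≅ (P ∣ Q) ∣ R
    par-unit  : ∀ {P} → P ∣ 𝟎 ≅ P
    par-comm  : ∀ {P Q} → P ∣ Q ≅ Q ∣ P
    res-nil   : ∀ {x} → ν[ x ] 𝟎 ≅ 𝟎
    res-par   : ∀ {x P Q} → x ∉ fn Q → (ν[ x ] P) ∣ Q ≅ ν[ x ] (P ∣ Q)
    res-swap  : ∀ {x y P} → ν[ x ] ν[ y ] P ≅ ν[ y ] ν[ x ] P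
    rep-unfold : ∀ {P} → ! P ≅ P ∣ ! P

  _↓_ : Process → Name → Set
  P ↓ x = ∃₂ λ z P′ → P —[ x ⦅ z ⦆ ]→ P′

  _↓̄_ : Process → Name → Set
  P ↓̄ x = (∃₂ λ y P′ → P —[ x ⟨ y ⟩ ]→ P′)
        ⊎ (∃₂ λ z P′ → P —[ x ⟨ν z ⟩ ]→ P′)

  record IsStrongBarbedSimulation (R : Rel Process 0ℓ) : Set where
    field
      barb-in  : ∀ {P Q} → R P Q → ∀ x → P ↓ x → Q ↓ x
      barb-out : ∀ {P Q} → R P Q → ∀ x → P ↓̄ x → Q ↓̄ x
      step     : ∀ {P Q P′} → R P Q → P —[ τ ]→ P′ →
                 ∃[ Q′ ] (Q —[ τ ]→ Q′ × R P′ Q′)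

  _≤B_ : Rel Process (lsuc 0ℓ)
  P ≤B Q = Σ (Rel Process 0ℓ) λ R → IsStrongBarbedSimulation R × R P Q

{-# OPTIONS --safe #-}
-- Structural congruence is itself a strong barbed simulation, because it
-- satisfies the harmony property: if P ≅ Q, every transition of P, with any
-- label, is matched by Q up to ≅.  This is proved by induction on P ≅ Q.  The
-- bound name of an action and the name of a restriction can be replaced by a
-- fresh one: transitions are invariant under injective renamings, and a
-- transposition of two names that are not free in a process fixes it.  For
-- communications, ≅ is moreover closed under arbitrary renamings, hence under
-- substitution.
-- For restriction, a transition of (νx)P whose bound name is not x comes from
-- P by S-Res or S-Open, so {((νx)P, (νx)Q) | P ℛ Q} is a simulation if ℛ is one.
module Submission where

open import Defs
open import Data.Bool using (if_then_else_)
open import Data.Fin.Relation.Unary.Top using (view; ‵fromℕ; ‵inj₁; view-fromℕ; view-inject₁)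
open import Data.List using (List; []; _∷_; _++_; map; filter)
open import Data.List.Membership.Propositional using (_∈_; _∉_)
open import Data.List.Membership.Propositional.Properties
  using (∈-++⁺ˡ; ∈-++⁺ʳ; ∈-++⁻; ∈-map⁺; ∈-map⁻; ∈-filter⁺; ∈-filter⁻)
open import Data.List.Properties using (map-++; filter-++; ++-assoc; ++-identityʳ)
open import Data.List.Relation.Binary.Subset.Propositional using (_⊆_)
open import Data.List.Relation.Binary.Subset.Propositional.Properties using (++⁺; ++⁺ʳ)
open import Data.List.Relation.Unary.Any using (here; there)
open import Data.Nat using (suc)
open import Data.Product using (_×_; _,_; proj₁; proj₂; ∃-syntax; ∃₂)
open import Data.Sum using (_⊎_; inj₁; inj₂; [_,_]′)
open import Function using (_∘_; id)
open import Function.Definitions using (Injective)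
open import Level using (0ℓ)
open import Relation.Binary.Core using (Rel)
open import Relation.Binary.Structures using (IsPreorder)
open import Relation.Binary.PropositionalEquality
  using (_≡_; _≢_; refl; sym; trans; cong; cong₂; subst; subst₂; ≢-sym; isEquivalence)
open import Relation.Nullary using (yes; no; does; ¬?; contradiction)

-- Barbs and `τ` alone would not support an induction on `≅`: a `τ` of `P ∣ Q` is assembled from
-- visible steps of the two sides, so all labels have to be matched. The obstacle is that `ν[ x ] P`
-- and `x ⦅ y ⦆∙ P` are computed by `abs`: one process has many presentations, and a transition of
-- `ν[ x ] P` may have been derived with a name other than `x`. `abs-≡` relates two presentations by
-- a transposition, and `res-inv` uses it to bring a derivation back to the chosen `x`. Labels that
-- bind `x` are excluded there, yet they do occur, since `x` is fresh for `ν[ x ] P`; hence the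
-- repeated passage to a fresh name.

module Renaming (𝒩 : Names) where

  open π-Calculus 𝒩

  -- Renamings of free names and their interaction with binders.

  renRef : ∀ {n} → (Name → Name) → Ref n → Ref n
  renRef σ (name x) = name (σ x)
  renRef σ (idx i)  = idx i

  ren : ∀ {n} → (Name → Name) → Proc n → Proc n
  ren σ 𝟎           = 𝟎
  ren σ (inp a P)   = inp (renRef σ a) (ren σ P)
  ren σ (out a b P) = out (renRef σ a) (renRef σ b) (ren σ P)
  ren σ (P ∣ Q)     = ren σ P ∣ ren σ Q
  ren σ (res P)     = res (ren σ P)
  ren σ (! P)       = ! ren σ P

  out-≡ : ∀ {n} {a a′ b b′ : Ref n} {P P′} → a ≡ a′ → b ≡ b′ → P ≡ P′ →
          out a b P ≡ out a′ b′ P′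
  out-≡ refl refl refl = refl

  res-injective : ∀ {n} {P Q : Proc (suc n)} → res P ≡ res Q → P ≡ Q
  res-injective refl = refl

  module _ {σ ρ : Name → Name} where

    renRef-cong : ∀ {n} (a : Ref n) → (∀ {x} → x ∈ fnRef a → σ x ≡ ρ x) →
                  renRef σ a ≡ renRef ρ a
    renRef-cong (name x) e = cong name (e (here refl))
    renRef-cong (idx i)  e = refl

    ren-cong : ∀ {n} (P : Proc n) → (∀ {x} → x ∈ fn P → σ x ≡ ρ x) →
               ren σ P ≡ ren ρ P
    ren-cong 𝟎 e = refl
    ren-cong (inp a P) e =
      cong₂ inp (renRef-cong a (e ∘ ∈-++⁺ˡ)) (ren-cong P (e ∘ ∈-++⁺ʳ (fnRef a)))
    ren-cong (out a b P) e =
      out-≡ (renRef-cong a (e ∘ ∈-++⁺ˡ))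
            (renRef-cong b (e ∘ ∈-++⁺ʳ (fnRef a) ∘ ∈-++⁺ˡ))
            (ren-cong P (e ∘ ∈-++⁺ʳ (fnRef a) ∘ ∈-++⁺ʳ (fnRef b)))
    ren-cong (P ∣ Q) e =
      cong₂ _∣_ (ren-cong P (e ∘ ∈-++⁺ˡ)) (ren-cong Q (e ∘ ∈-++⁺ʳ (fn P)))
    ren-cong (res P) e = cong res (ren-cong P e)
    ren-cong (! P)   e = cong !_ (ren-cong P e)

    renRef-∘ : ∀ {n} (a : Ref n) → renRef σ (renRef ρ a) ≡ renRef (σ ∘ ρ) a
    renRef-∘ (name x) = refl
    renRef-∘ (idx i)  = refl

    ren-∘ : ∀ {n} (P : Proc n) → ren σ (ren ρ P) ≡ ren (σ ∘ ρ) P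
    ren-∘ 𝟎           = refl
    ren-∘ (inp a P)   = cong₂ inp (renRef-∘ a) (ren-∘ P)
    ren-∘ (out a b P) = out-≡ (renRef-∘ a) (renRef-∘ b) (ren-∘ P)
    ren-∘ (P ∣ Q)     = cong₂ _∣_ (ren-∘ P) (ren-∘ Q)
    ren-∘ (res P)     = cong res (ren-∘ P)
    ren-∘ (! P)       = cong !_ (ren-∘ P)

  renRef-id : ∀ {n} (a : Ref n) → renRef id a ≡ a
  renRef-id (name x) = refl
  renRef-id (idx i)  = refl

  ren-id : ∀ {n} (P : Proc n) → ren id P ≡ P
  ren-id 𝟎           = refl
  ren-id (inp a P)   = cong₂ inp (renRef-id a) (ren-id P)
  ren-id (out a b P) = out-≡ (renRef-id a) (renRef-id b) (ren-id P)
  ren-id (P ∣ Q)     = cong₂ _∣_ (ren-id P) (ren-id Q)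
  ren-id (res P)     = cong res (ren-id P)
  ren-id (! P)       = cong !_ (ren-id P)

  ren-fixed : ∀ {n σ} (P : Proc n) → (∀ {x} → x ∈ fn P → σ x ≡ x) → ren σ P ≡ P
  ren-fixed P e = trans (ren-cong P e) (ren-id P)

  ren-≗ : ∀ {n σ σ′ ρ ρ′} (P : Proc n) →
          (∀ {x} → x ∈ fn P → σ (σ′ x) ≡ ρ (ρ′ x)) →
          ren σ (ren σ′ P) ≡ ren ρ (ren ρ′ P)
  ren-≗ P e = trans (ren-∘ P) (trans (ren-cong P e) (sym (ren-∘ P)))

  fn-renRef : ∀ {n} σ (a : Ref n) → fnRef (renRef σ a) ≡ map σ (fnRef a)
  fn-renRef σ (name x) = refl
  fn-renRef σ (idx i)  = refl

  fn-ren : ∀ {n} σ (P : Proc n) → fn (ren σ P) ≡ map σ (fn P)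
  fn-ren σ 𝟎 = refl
  fn-ren σ (inp a P) =
    trans (cong₂ _++_ (fn-renRef σ a) (fn-ren σ P)) (sym (map-++ σ (fnRef a) (fn P)))
  fn-ren σ (out a b P) =
    trans (cong₂ _++_ (fn-renRef σ a)
            (trans (cong₂ _++_ (fn-renRef σ b) (fn-ren σ P))
                   (sym (map-++ σ (fnRef b) (fn P)))))
          (sym (map-++ σ (fnRef a) (fnRef b ++ fn P)))
  fn-ren σ (P ∣ Q) =
    trans (cong₂ _++_ (fn-ren σ P) (fn-ren σ Q)) (sym (map-++ σ (fn P) (fn Q)))
  fn-ren σ (res P) = fn-ren σ P
  fn-ren σ (! P)   = fn-ren σ P

  fn-ren⁺ : ∀ {n σ x} (P : Proc n) → x ∈ fn P → σ x ∈ fn (ren σ P)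
  fn-ren⁺ {σ = σ} P x∈ = subst (_ ∈_) (sym (fn-ren σ P)) (∈-map⁺ σ x∈)

  fn-ren⁻ : ∀ {n σ x} (P : Proc n) → x ∈ fn (ren σ P) → ∃[ y ] y ∈ fn P × x ≡ σ y
  fn-ren⁻ {σ = σ} P x∈ = ∈-map⁻ σ (subst (_ ∈_) (fn-ren σ P) x∈)

  fn-absRef : ∀ {n} z (a : Ref n) →
              fnRef (absRef z a) ≡ filter (λ x → ¬? (z ≟ x)) (fnRef a)
  fn-absRef z (name x) with z ≟ x
  ... | yes _ = refl
  ... | no _  = refl
  fn-absRef z (idx i) = refl

  fn-abs : ∀ {n} z (P : Proc n) → fn (abs z P) ≡ filter (λ x → ¬? (z ≟ x)) (fn P)
  fn-abs z 𝟎 = refl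
  fn-abs z (inp a P) =
    trans (cong₂ _++_ (fn-absRef z a) (fn-abs z P)) (sym (filter-++ _ (fnRef a) (fn P)))
  fn-abs z (out a b P) =
    trans (cong₂ _++_ (fn-absRef z a)
            (trans (cong₂ _++_ (fn-absRef z b) (fn-abs z P))
                   (sym (filter-++ _ (fnRef b) (fn P)))))
          (sym (filter-++ _ (fnRef a) (fnRef b ++ fn P)))
  fn-abs z (P ∣ Q) =
    trans (cong₂ _++_ (fn-abs z P) (fn-abs z Q)) (sym (filter-++ _ (fn P) (fn Q)))
  fn-abs z (res P) = fn-abs z P
  fn-abs z (! P)   = fn-abs z P

  fn-abs⁺ : ∀ {n z x} (P : Proc n) → x ∈ fn P → z ≢ x → x ∈ fn (abs z P)
  fn-abs⁺ {z = z} P x∈ z≢x = subst (_ ∈_) (sym (fn-abs z P)) (∈-filter⁺ _ x∈ z≢x)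

  fn-abs⁻ : ∀ {n z x} (P : Proc n) → x ∈ fn (abs z P) → x ∈ fn P × z ≢ x
  fn-abs⁻ {z = z} P x∈ =
    ∈-filter⁻ (λ x → ¬? (z ≟ x)) {xs = fn P} (subst (_ ∈_) (fn-abs z P) x∈)

  abs-⊆ : ∀ {n z} {P Q : Proc n} → fn P ⊆ fn Q → fn (abs z P) ⊆ fn (abs z Q)
  abs-⊆ {P = P} {Q} f m with m′ , z≢ ← fn-abs⁻ P m = fn-abs⁺ Q (f m′) z≢

  z∉abs : ∀ {n z} (P : Proc n) → z ∉ fn (abs z P)
  z∉abs P z∈ = proj₂ (fn-abs⁻ P z∈) refl

  module _ {σ ρ : Name → Name} {z w : Name} (ρz≡w : ρ z ≡ w) where

    absRef-ren : ∀ {n} (a : Ref n) →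
                 (∀ {x} → x ∈ fnRef a → z ≢ x → ρ x ≡ σ x × w ≢ σ x) →
                 absRef w (renRef ρ a) ≡ renRef σ (absRef z a)
    absRef-ren (name x) e with z ≟ x | w ≟ ρ x
    ... | yes _   | yes _ = refl
    ... | yes z≡x | no w≢ = contradiction (trans (sym ρz≡w) (cong ρ z≡x)) w≢
    ... | no z≢x  | yes w≡ =
      contradiction (trans w≡ (proj₁ (e (here refl) z≢x))) (proj₂ (e (here refl) z≢x))
    ... | no z≢x  | no _ = cong name (proj₁ (e (here refl) z≢x))
    absRef-ren (idx i) e = refl

    -- No free name other than `z` reaches `w`, so abstracting `w` after the renaming catches
    -- exactly the old occurrences of `z`. Keeping `ρ` and `σ` separate lets one lemma serve
    -- injective renamings, updated renamings and substitutions.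
    abs-ren : ∀ {n} (P : Proc n) →
              (∀ {x} → x ∈ fn P → z ≢ x → ρ x ≡ σ x × w ≢ σ x) →
              abs w (ren ρ P) ≡ ren σ (abs z P)
    abs-ren 𝟎 e = refl
    abs-ren (inp a P) e =
      cong₂ inp (absRef-ren a (e ∘ ∈-++⁺ˡ)) (abs-ren P (e ∘ ∈-++⁺ʳ (fnRef a)))
    abs-ren (out a b P) e =
      out-≡ (absRef-ren a (e ∘ ∈-++⁺ˡ))
            (absRef-ren b (e ∘ ∈-++⁺ʳ (fnRef a) ∘ ∈-++⁺ˡ))
            (abs-ren P (e ∘ ∈-++⁺ʳ (fnRef a) ∘ ∈-++⁺ʳ (fnRef b)))
    abs-ren (P ∣ Q) e =
      cong₂ _∣_ (abs-ren P (e ∘ ∈-++⁺ˡ)) (abs-ren Q (e ∘ ∈-++⁺ʳ (fn P)))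
    abs-ren (res P) e = cong res (abs-ren P e)
    abs-ren (! P)   e = cong !_ (abs-ren P e)

  -- Opening the outermost binder, the one `abs` creates: the view separates its index, the largest,
  -- from the shifted ones. It serves as left inverse of `abs`, to obtain `abs-injective`.
  instRef : ∀ {n} → Name → Ref (suc n) → Ref n
  instRef z (name x) = name x
  instRef z (idx i) with view i
  ... | ‵fromℕ         = name z
  ... | ‵inj₁ {i = j} _ = idx j

  inst : ∀ {n} → Name → Proc (suc n) → Proc n
  inst z 𝟎           = 𝟎
  inst z (inp a P)   = inp (instRef z a) (inst z P)
  inst z (out a b P) = out (instRef z a) (instRef z b) (inst z P)
  inst z (P ∣ Q)     = inst z P ∣ inst z Q
  inst z (res P)     = res (inst z P)
  inst z (! P)       = ! inst z P

  instRef-abs : ∀ {n} z (a : Ref n) → instRef z (absRef z a) ≡ a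
  instRef-abs {n} z (name x) with z ≟ x
  ... | no _ = refl
  ... | yes refl rewrite view-fromℕ n = refl
  instRef-abs z (idx i) rewrite view-inject₁ i = refl

  inst-abs : ∀ {n} z (P : Proc n) → inst z (abs z P) ≡ P
  inst-abs z 𝟎           = refl
  inst-abs z (inp a P)   = cong₂ inp (instRef-abs z a) (inst-abs z P)
  inst-abs z (out a b P) = out-≡ (instRef-abs z a) (instRef-abs z b) (inst-abs z P)
  inst-abs z (P ∣ Q)     = cong₂ _∣_ (inst-abs z P) (inst-abs z Q)
  inst-abs z (res P)     = cong res (inst-abs z P)
  inst-abs z (! P)       = cong !_ (inst-abs z P)

  abs-injective : ∀ {n} z {P Q : Proc n} → abs z P ≡ abs z Q → P ≡ Q
  abs-injective z {P} {Q} e =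
    trans (sym (inst-abs z P)) (trans (cong (inst z) e) (inst-abs z Q))

  sub : Name → Name → Name → Name
  sub y z x = if does (z ≟ x) then y else x

  sub-hit : ∀ y z → sub y z z ≡ y
  sub-hit y z with z ≟ z
  ... | yes _  = refl
  ... | no z≢z = contradiction refl z≢z

  sub-miss : ∀ {y z x} → z ≢ x → sub y z x ≡ x
  sub-miss {z = z} {x} z≢x with z ≟ x
  ... | yes z≡x = contradiction z≡x z≢x
  ... | no _    = refl

  sub-dec : ∀ {y z} x → (z ≡ x × sub y z x ≡ y) ⊎ (z ≢ x × sub y z x ≡ x)
  sub-dec {z = z} x with z ≟ x
  ... | yes z≡x = inj₁ (z≡x , refl)
  ... | no z≢x  = inj₂ (z≢x , refl)

  substRef-sub : ∀ {n y z} (a : Ref n) → substRef y z a ≡ renRef (sub y z) a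
  substRef-sub {z = z} (name x) with z ≟ x
  ... | yes _ = refl
  ... | no _  = refl
  substRef-sub (idx i) = refl

  -- Facts about substitution thus come from facts about `ren`. The renaming `sub y z` identifies
  -- `z` with `y`, so in general it is not injective.
  subst-sub : ∀ {n y z} (P : Proc n) → P [ y / z ] ≡ ren (sub y z) P
  subst-sub 𝟎           = refl
  subst-sub (inp a P)   = cong₂ inp (substRef-sub a) (subst-sub P)
  subst-sub (out a b P) = out-≡ (substRef-sub a) (substRef-sub b) (subst-sub P)
  subst-sub (P ∣ Q)     = cong₂ _∣_ (subst-sub P) (subst-sub Q)
  subst-sub (res P)     = cong res (subst-sub P)
  subst-sub (! P)       = cong !_ (subst-sub P)

  subst-∉ : ∀ {n y z} (P : Proc n) → z ∉ fn P → P [ y / z ] ≡ P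
  subst-∉ P z∉ = trans (subst-sub P)
    (ren-fixed P (λ x∈ → sub-miss (λ { refl → z∉ x∈ })))

  fn-subst : ∀ {n y z x} (P : Proc n) → x ∈ fn (P [ y / z ]) →
             x ≡ y ⊎ (x ∈ fn P × z ≢ x)
  fn-subst {y = y} {z} P x∈
    with u , u∈ , refl ← fn-ren⁻ P (subst (λ R → _ ∈ fn R) (subst-sub P) x∈)
    with sub-dec {y} {z} u
  ... | inj₁ (_ , e)   = inj₁ e
  ... | inj₂ (z≢u , e) rewrite e = inj₂ (u∈ , z≢u)

  subst-ren : ∀ {n σ} → Injective _≡_ _≡_ σ → ∀ {y z} (P : Proc n) →
              ren σ P [ σ y / σ z ] ≡ ren σ (P [ y / z ])
  subst-ren {σ = σ} σ-inj {y} {z} P =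
    trans (subst-sub (ren σ P))
      (trans (ren-≗ P (λ {x} _ → sub-σ x)) (cong (ren σ) (sym (subst-sub P))))
    where
    sub-σ : ∀ x → sub (σ y) (σ z) (σ x) ≡ σ (sub y z x)
    sub-σ x with sub-dec {y} {z} x
    ... | inj₁ (refl , e) = trans (sub-hit (σ y) (σ z)) (cong σ (sym e))
    ... | inj₂ (z≢x , e)  = trans (sub-miss (z≢x ∘ σ-inj)) (cong σ (sym e))

  -- Transpositions and α-conversion.

  swap : Name → Name → Name → Name
  swap a b x = if does (a ≟ x) then b else sub a b x

  swap-l : ∀ a b → swap a b a ≡ b
  swap-l a b with a ≟ a
  ... | yes _  = refl
  ... | no a≢a = contradiction refl a≢a

  swap-r : ∀ a b → swap a b b ≡ a
  swap-r a b with a ≟ b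
  ... | yes refl = refl
  ... | no _     = sub-hit a b

  swap-other : ∀ {a b x} → a ≢ x → b ≢ x → swap a b x ≡ x
  swap-other {a} {b} {x} a≢x b≢x with a ≟ x
  ... | yes a≡x = contradiction a≡x a≢x
  ... | no _    = sub-miss b≢x

  swap-sym : ∀ a b x → swap a b x ≡ swap b a x
  swap-sym a b x with a ≟ x | b ≟ x
  ... | yes refl | yes refl = refl
  ... | yes _    | no _     = refl
  ... | no _     | yes _    = refl
  ... | no _     | no _     = refl

  swap-involutive : ∀ a b x → swap a b (swap a b x) ≡ x
  swap-involutive a b x with a ≟ x
  ... | yes refl = swap-r a b
  ... | no a≢x with b ≟ x
  ...   | yes refl = swap-l a b
  ...   | no b≢x   = swap-other a≢x b≢x

  swap-injective : ∀ a b → Injective _≡_ _≡_ (swap a b)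
  swap-injective a b {x} {y} e =
    trans (sym (swap-involutive a b x))
      (trans (cong (swap a b) e) (swap-involutive a b y))

  ren-swap-swap : ∀ {n} a b (P : Proc n) → ren (swap a b) (ren (swap a b) P) ≡ P
  ren-swap-swap a b P =
    trans (ren-∘ P) (ren-fixed P (λ {x} _ → swap-involutive a b x))

  ren-swap-∉ : ∀ {n a b} (P : Proc n) → a ∉ fn P → b ∉ fn P → ren (swap a b) P ≡ P
  ren-swap-∉ P a∉ b∉ =
    ren-fixed P (λ x∈ → swap-other (λ { refl → a∉ x∈ }) (λ { refl → b∉ x∈ }))

  abs-ren-inj : ∀ {n σ} → Injective _≡_ _≡_ σ → ∀ z (P : Proc n) →
                abs (σ z) (ren σ P) ≡ ren σ (abs z P)
  abs-ren-inj σ-inj z P = abs-ren refl P (λ _ z≢x → refl , z≢x ∘ σ-inj)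

  -- This is α-conversion: `abs` commutes with the transposition, which then acts on a term where
  -- neither `z` nor `w` is free.
  abs-swap : ∀ {n} z w (P : Proc n) → w ∉ fn (abs z P) →
             abs w (ren (swap z w) P) ≡ abs z P
  abs-swap z w P w∉ = trans
    (cong (λ v → abs v (ren (swap z w) P)) (sym (swap-l z w)))
    (trans (abs-ren-inj (swap-injective z w) z P)
           (ren-swap-∉ (abs z P) (z∉abs P) w∉))

  -- The common abstraction has no free `z`, so `abs w Q` can be presented with `z` by `abs-swap`;
  -- injectivity of `abs z` then compares the bodies.
  abs-≡ : ∀ {n} z w {P Q : Proc n} → abs z P ≡ abs w Q → P ≡ ren (swap w z) Q
  abs-≡ z w {P} {Q} e =
    abs-injective z (trans e (sym (abs-swap w z Q (subst (λ R → z ∉ fn R) e (z∉abs P)))))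

  -- The two maps differ only at `y`, which does not occur.
  swap-sub : ∀ {n y z} (P : Proc n) → y ∉ fn P → ren (swap y z) P ≡ P [ y / z ]
  swap-sub {y = y} {z} P y∉ = trans (ren-cong P e) (sym (subst-sub P))
    where
    e : ∀ {u} → u ∈ fn P → swap y z u ≡ sub y z u
    e {u} u∈ with y ≟ u
    ... | yes refl = contradiction u∈ y∉
    ... | no _     = refl

-- Names in transitions, equivariance, and inversion of restriction.

module Transitions (𝒩 : Names) where

  open π-Calculus 𝒩
  open Renaming 𝒩

  renAct : (Name → Name) → Action → Action
  renAct σ (a ⦅ z ⦆)  = σ a ⦅ σ z ⦆
  renAct σ (a ⟨ y ⟩)  = σ a ⟨ σ y ⟩
  renAct σ (a ⟨ν z ⟩) = σ a ⟨ν σ z ⟩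
  renAct σ τ          = τ

  -- Binders and substitution are functions on terms, so the shapes that a rule prescribes are often
  -- available only up to a propositional equality.
  step-≡ : ∀ {α β P P₁ P′ P₁′} → P ≡ P₁ → α ≡ β → P′ ≡ P₁′ →
           P —[ α ]→ P′ → P₁ —[ β ]→ P₁′
  step-≡ refl refl refl t = t

  fa : Action → List Name
  fa (a ⦅ z ⦆)  = a ∷ []
  fa (a ⟨ y ⟩)  = a ∷ y ∷ []
  fa (a ⟨ν z ⟩) = a ∷ []
  fa τ          = []

  n⇒fa⊎bn : ∀ {x} α → x ∈ n⟦ α ⟧ → x ∈ fa α ⊎ x ∈ bn α
  n⇒fa⊎bn (a ⦅ z ⦆)  (here e)  = inj₁ (here e)
  n⇒fa⊎bn (a ⦅ z ⦆)  (there m) = inj₂ m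
  n⇒fa⊎bn (a ⟨ y ⟩)  m         = inj₁ m
  n⇒fa⊎bn (a ⟨ν z ⟩) (here e)  = inj₁ (here e)
  n⇒fa⊎bn (a ⟨ν z ⟩) (there m) = inj₂ m

  fa⇒n : ∀ {x} α → x ∈ fa α → x ∈ n⟦ α ⟧
  fa⇒n (a ⦅ z ⦆)  (here e) = here e
  fa⇒n (a ⟨ y ⟩)  m        = m
  fa⇒n (a ⟨ν z ⟩) (here e) = here e

  ∉-singleton : ∀ {x y : Name} → x ≢ y → x ∉ y ∷ []
  ∉-singleton x≢y (here e) = x≢y e

  step-fa : ∀ {α P P′} → P —[ α ]→ P′ → ∀ {x} → x ∈ fa α → x ∈ fn P
  step-fa (S-In _) (here e) = here e
  step-fa S-Out (here e) = here e
  step-fa S-Out (there (here e)) = there (here e)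
  step-fa (S-Par-L t _) m = ∈-++⁺ˡ (step-fa t m)
  step-fa (S-Par-R {P = P} t _) m = ∈-++⁺ʳ (fn P) (step-fa t m)
  step-fa (S-Res {α} {P = P} t z∉) m =
    fn-abs⁺ P (step-fa t m) λ { refl → z∉ (fa⇒n α m) }
  step-fa (S-Open {P = P} t z≢x) (here refl) = fn-abs⁺ P (step-fa t (here refl)) z≢x
  step-fa (S-Rep t) m = step-fa t m

  step-bn : ∀ {α P P′} → P —[ α ]→ P′ → ∀ {x} → x ∈ bn α → x ∉ fn P
  step-bn (S-In z∉) (here refl) = z∉
  step-bn (S-Par-L {P = P} t f) m = [ step-bn t m , f m ]′ ∘ ∈-++⁻ (fn P)
  step-bn (S-Par-R {P = P} t f) m = [ f m , step-bn t m ]′ ∘ ∈-++⁻ (fn P)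
  step-bn (S-Res {P = P} t _) m = step-bn t m ∘ proj₁ ∘ fn-abs⁻ P
  step-bn (S-Open {P = P} _ _) (here refl) = z∉abs P
  step-bn (S-Rep t) m = step-bn t m

  -- Declared before its clauses because the helpers for the premises of a communication are
  -- mutually recursive with it.
  step-fn : ∀ {α P P′} → P —[ α ]→ P′ → ∀ {x} → x ∈ fn P′ → x ∈ fn P ⊎ x ∈ bn α

  -- The received `y` is free in the sender, and the only name an input can add is `z`, which the
  -- substitution removes.
  com-fn : ∀ {a y z P P′ Q Q′} → P —[ a ⟨ y ⟩ ]→ P′ → Q —[ a ⦅ z ⦆ ]→ Q′ →
           ∀ {x} → x ∈ fn (Q′ [ y / z ]) → x ∈ fn P ⊎ x ∈ fn Q
  com-fn {Q′ = Q′} t u m with fn-subst Q′ m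
  ... | inj₁ refl = inj₁ (step-fa t (there (here refl)))
  ... | inj₂ (m′ , z≢x) with step-fn u m′
  ...   | inj₁ k        = inj₂ k
  ...   | inj₂ (here e) = contradiction (sym e) z≢x

  out-fn : ∀ {a y P P′} → P —[ a ⟨ y ⟩ ]→ P′ → ∀ {x} → x ∈ fn P′ → x ∈ fn P
  out-fn t m with step-fn t m
  ... | inj₁ k = k

  -- The equation on `bn α` treats inputs and bound outputs alike.
  bound-fn : ∀ {α z P P′} → bn α ≡ z ∷ [] → P —[ α ]→ P′ →
             ∀ {x} → z ≢ x → x ∈ fn P′ → x ∈ fn P
  bound-fn e t z≢x m with step-fn t m
  ... | inj₁ k = k
  ... | inj₂ k with here refl ← subst (_ ∈_) e k = contradiction refl z≢x

  step-fn (S-In {x} {z} {P} _) {u} m with z ≟ u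
  ... | yes refl = inj₂ (here refl)
  ... | no z≢u   = inj₁ (there (fn-abs⁺ P m z≢u))
  step-fn S-Out m = inj₁ (there (there m))
  step-fn (S-Par-L {P = P} {P′} t _) m with ∈-++⁻ (fn P′) m
  ... | inj₂ k = inj₁ (∈-++⁺ʳ (fn P) k)
  ... | inj₁ k with step-fn t k
  ...   | inj₁ l = inj₁ (∈-++⁺ˡ l)
  ...   | inj₂ l = inj₂ l
  step-fn (S-Par-R {P = P} t _) m with ∈-++⁻ (fn P) m
  ... | inj₁ k = inj₁ (∈-++⁺ˡ k)
  ... | inj₂ k with step-fn t k
  ...   | inj₁ l = inj₁ (∈-++⁺ʳ (fn P) l)
  ...   | inj₂ l = inj₂ l
  step-fn (S-Com-L {P = P} {P′} t u) m with ∈-++⁻ (fn P′) m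
  ... | inj₁ k = inj₁ (∈-++⁺ˡ (out-fn t k))
  ... | inj₂ k = inj₁ ([ ∈-++⁺ˡ , ∈-++⁺ʳ (fn P) ]′ (com-fn t u k))
  step-fn (S-Com-R {y = y} {z} {P} {P′} t u) m with ∈-++⁻ (fn (P′ [ y / z ])) m
  ... | inj₁ k = inj₁ ([ ∈-++⁺ʳ (fn P) , ∈-++⁺ˡ ]′ (com-fn u t k))
  ... | inj₂ k = inj₁ (∈-++⁺ʳ (fn P) (out-fn u k))
  step-fn (S-Res {P = P} {P′} t _) m with fn-abs⁻ P′ m
  ... | k , z≢ with step-fn t k
  ...   | inj₁ l = inj₁ (fn-abs⁺ P l z≢)
  ...   | inj₂ l = inj₂ l
  step-fn (S-Open {x} {z} {P} t _) {u} m with z ≟ u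
  ... | yes refl = inj₂ (here refl)
  ... | no z≢u   = inj₁ (fn-abs⁺ P (out-fn t m) z≢u)
  step-fn (S-Close-L {P = P} {P′} {Q} {Q′} t u) m with fn-abs⁻ (P′ ∣ Q′) m
  ... | k , z≢ with ∈-++⁻ (fn P′) k
  ...   | inj₁ l = inj₁ (∈-++⁺ˡ (bound-fn refl t z≢ l))
  ...   | inj₂ l = inj₁ (∈-++⁺ʳ (fn P) (bound-fn refl u z≢ l))
  step-fn (S-Close-R {P = P} {P′} {Q} {Q′} t u) m with fn-abs⁻ (P′ ∣ Q′) m
  ... | k , z≢ with ∈-++⁻ (fn P′) k
  ...   | inj₁ l = inj₁ (∈-++⁺ˡ (bound-fn refl t z≢ l))
  ...   | inj₂ l = inj₁ (∈-++⁺ʳ (fn P) (bound-fn refl u z≢ l))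
  step-fn (S-Rep {P′ = P′} t) m with ∈-++⁻ (fn P′) m
  ... | inj₁ k = step-fn t k
  ... | inj₂ k = inj₁ k
  step-fn (S-Rep-Com {y = y} {z} {P} {P′} {P″} t u) m
    with ∈-++⁻ (fn (P′ ∣ (P″ [ y / z ]))) m
  ... | inj₂ k = inj₁ k
  ... | inj₁ k with ∈-++⁻ (fn P′) k
  ...   | inj₁ l = inj₁ (out-fn t l)
  ...   | inj₂ l = inj₁ ([ id , id ]′ (com-fn t u l))
  step-fn (S-Rep-Close {z = z} {P} {P′} {P″} t u) m
    with ∈-++⁻ (fn (ν[ z ] (P′ ∣ P″))) m
  ... | inj₂ k = inj₁ k
  ... | inj₁ k with fn-abs⁻ (P′ ∣ P″) k
  ...   | l , z≢ with ∈-++⁻ (fn P′) l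
  ...     | inj₁ j = inj₁ (bound-fn refl t z≢ j)
  ...     | inj₂ j = inj₁ (bound-fn refl u z≢ j)

  bn-renAct : ∀ σ α → bn (renAct σ α) ≡ map σ (bn α)
  bn-renAct σ (a ⦅ z ⦆)  = refl
  bn-renAct σ (a ⟨ y ⟩)  = refl
  bn-renAct σ (a ⟨ν z ⟩) = refl
  bn-renAct σ τ          = refl

  n-renAct : ∀ σ α → n⟦ renAct σ α ⟧ ≡ map σ n⟦ α ⟧
  n-renAct σ (a ⦅ z ⦆)  = refl
  n-renAct σ (a ⟨ y ⟩)  = refl
  n-renAct σ (a ⟨ν z ⟩) = refl
  n-renAct σ τ          = refl

  renAct-fixed : ∀ {σ} α → (∀ {x} → x ∈ n⟦ α ⟧ → σ x ≡ x) → renAct σ α ≡ α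
  renAct-fixed (a ⦅ z ⦆)  e = cong₂ _⦅_⦆ (e (here refl)) (e (there (here refl)))
  renAct-fixed (a ⟨ y ⟩)  e = cong₂ _⟨_⟩ (e (here refl)) (e (there (here refl)))
  renAct-fixed (a ⟨ν z ⟩) e = cong₂ _⟨ν_⟩ (e (here refl)) (e (there (here refl)))
  renAct-fixed τ          e = refl

  renAct-swap-swap : ∀ a b α → renAct (swap a b) (renAct (swap a b) α) ≡ α
  renAct-swap-swap a b (c ⦅ z ⦆)  =
    cong₂ _⦅_⦆ (swap-involutive a b c) (swap-involutive a b z)
  renAct-swap-swap a b (c ⟨ y ⟩)  =
    cong₂ _⟨_⟩ (swap-involutive a b c) (swap-involutive a b y)
  renAct-swap-swap a b (c ⟨ν z ⟩) =
    cong₂ _⟨ν_⟩ (swap-involutive a b c) (swap-involutive a b z)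
  renAct-swap-swap a b τ = refl

  module _ {σ : Name → Name} (σ-inj : Injective _≡_ _≡_ σ) where

    ∉-ren : ∀ {n x} (P : Proc n) → x ∉ fn P → σ x ∉ fn (ren σ P)
    ∉-ren P x∉ m with y , y∈ , e ← fn-ren⁻ P m rewrite σ-inj e = x∉ y∈

    bn-ren : ∀ α (P : Process) → (∀ {z} → z ∈ bn α → z ∉ fn P) →
             ∀ {z} → z ∈ bn (renAct σ α) → z ∉ fn (ren σ P)
    bn-ren α P f m
      with y , y∈ , refl ← ∈-map⁻ σ (subst (_ ∈_) (bn-renAct σ α) m) = ∉-ren P (f y∈)

    -- Injectivity preserves the freshness and distinctness premises of the rules, and makes `σ`
    -- commute with `abs` and with substitution.
    step-ren : ∀ {α P P′} → P —[ α ]→ P′ → ren σ P —[ renAct σ α ]→ ren σ P′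
    step-ren (S-In {x} {z} {P} z∉) =
      step-≡ (cong (inp _) e) refl refl
        (S-In (subst (λ B → σ z ∉ fn (inp (name (σ x)) B)) (sym e)
                (∉-ren (x ⦅ z ⦆∙ P) z∉)))
      where
      e : abs (σ z) (ren σ P) ≡ ren σ (abs z P)
      e = abs-ren-inj σ-inj z P
    step-ren S-Out = S-Out
    step-ren (S-Par-L {α} {Q = Q} t f) = S-Par-L (step-ren t) (bn-ren α Q f)
    step-ren (S-Par-R {α} {P = P} t f) = S-Par-R (step-ren t) (bn-ren α P f)
    step-ren (S-Com-L {Q′ = Q′} t u) =
      step-≡ refl refl (cong (_ ∣_) (subst-ren σ-inj Q′))
        (S-Com-L (step-ren t) (step-ren u))
    step-ren (S-Com-R {P′ = P′} t u) =
      step-≡ refl refl (cong (_∣ _) (subst-ren σ-inj P′))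
        (S-Com-R (step-ren t) (step-ren u))
    step-ren (S-Res {α} {z} {P} {P′} t z∉) =
      step-≡ (cong res (abs-ren-inj σ-inj z P)) refl (cong res (abs-ren-inj σ-inj z P′))
        (S-Res (step-ren t) σz∉)
      where
      σz∉ : σ z ∉ n⟦ renAct σ α ⟧
      σz∉ m with y , y∈ , e ← ∈-map⁻ σ (subst (_ ∈_) (n-renAct σ α) m)
            rewrite σ-inj e = z∉ y∈
    step-ren (S-Open {z = z} {P} t z≢x) =
      step-≡ (cong res (abs-ren-inj σ-inj z P)) refl refl
        (S-Open (step-ren t) (z≢x ∘ σ-inj))
    step-ren (S-Close-L {z = z} {P′ = P′} {Q′ = Q′} t u) =
      step-≡ refl refl (cong res (abs-ren-inj σ-inj z (P′ ∣ Q′)))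
        (S-Close-L (step-ren t) (step-ren u))
    step-ren (S-Close-R {z = z} {P′ = P′} {Q′ = Q′} t u) =
      step-≡ refl refl (cong res (abs-ren-inj σ-inj z (P′ ∣ Q′)))
        (S-Close-R (step-ren t) (step-ren u))
    step-ren (S-Rep t) = S-Rep (step-ren t)
    step-ren (S-Rep-Com {P″ = P″} t u) =
      step-≡ refl refl (cong (λ S → (_ ∣ S) ∣ _) (subst-ren σ-inj P″))
        (S-Rep-Com (step-ren t) (step-ren u))
    step-ren (S-Rep-Close {z = z} {P} {P′} {P″} t u) =
      step-≡ refl refl (cong (λ B → res B ∣ ! ren σ P) (abs-ren-inj σ-inj z (P′ ∣ P″)))
        (S-Rep-Close (step-ren t) (step-ren u))

  -- Both `z` and `w` are fresh for `P`, so the transposition fixes `P` and the channel, which is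
  -- free in `P`; only the bound name and the derivative change.
  refresh-in : ∀ {a z w P P′} → P —[ a ⦅ z ⦆ ]→ P′ → w ∉ fn P →
               P —[ a ⦅ w ⦆ ]→ ren (swap z w) P′
  refresh-in {a} {z} {w} {P} t w∉ =
    step-≡ (ren-swap-∉ P z∉ w∉)
      (cong₂ _⦅_⦆ (swap-other (λ { refl → z∉ a∈ }) (λ { refl → w∉ a∈ })) (swap-l z w))
      refl (step-ren (swap-injective z w) t)
    where
    z∉ = step-bn t (here refl)
    a∈ = step-fa t (here refl)

  refresh-bout : ∀ {a z w P P′} → P —[ a ⟨ν z ⟩ ]→ P′ → w ∉ fn P →
                 P —[ a ⟨ν w ⟩ ]→ ren (swap z w) P′
  refresh-bout {a} {z} {w} {P} t w∉ =
    step-≡ (ren-swap-∉ P z∉ w∉)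
      (cong₂ _⟨ν_⟩ (swap-other (λ { refl → z∉ a∈ }) (λ { refl → w∉ a∈ })) (swap-l z w))
      refl (step-ren (swap-injective z w) t)
    where
    z∉ = step-bn t (here refl)
    a∈ = step-fa t (here refl)

  -- A communication uses an input derivative only through its instances, and these do not depend on
  -- the chosen bound name.
  fresh-in : ∀ {a z P P′} → P —[ a ⦅ z ⦆ ]→ P′ → ∀ L →
             ∃₂ λ w P″ → w ∉ L × P —[ a ⦅ w ⦆ ]→ P″
                       × (∀ y → P″ [ y / w ] ≡ P′ [ y / z ])
  fresh-in {z = z} {P} {P′} t L with fresh (z ∷ L ++ fn P)
  ... | w , w∉ = w , ren (swap z w) P′ , w∉ ∘ there ∘ ∈-++⁺ˡ , refresh-in t w∉P , λ y →
    trans (subst-sub (ren (swap z w) P′))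
      (trans (ren-∘ P′) (trans (ren-cong P′ (e y)) (sym (subst-sub P′))))
    where
    w∉P : w ∉ fn P
    w∉P = w∉ ∘ there ∘ ∈-++⁺ʳ L

    z≢w : z ≢ w
    z≢w refl = w∉ (here refl)

    e : ∀ y {u} → u ∈ fn P′ → sub y w (swap z w u) ≡ sub y z u
    e y {u} u∈ with z ≟ u
    ... | yes refl = sub-hit y w
    ... | no z≢u with w ≟ u
    ...   | yes refl = contradiction (bound-fn refl t z≢w u∈) w∉P
    ...   | no w≢u   = sub-miss w≢u

  fresh-bout : ∀ {a z P P′} → P —[ a ⟨ν z ⟩ ]→ P′ → ∀ L →
               ∃₂ λ w P″ → w ∉ L × P —[ a ⟨ν w ⟩ ]→ P″
  fresh-bout {P = P} t L with fresh (L ++ fn P)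
  ... | w , w∉ = w , _ , w∉ ∘ ∈-++⁺ˡ , refresh-bout t (w∉ ∘ ∈-++⁺ʳ L)

  -- The two premises of a close share their bound name, so both are refreshed to the same `w`. The
  -- equations on abstractions say that the restricted result is unchanged.
  fresh-close : ∀ {a z P P′ Q Q′} → P —[ a ⟨ν z ⟩ ]→ P′ → Q —[ a ⦅ z ⦆ ]→ Q′ → ∀ L →
                ∃[ w ] ∃₂ λ P″ Q″ → w ∉ L × P —[ a ⟨ν w ⟩ ]→ P″ × Q —[ a ⦅ w ⦆ ]→ Q″
                  × abs w P″ ≡ abs z P′ × abs w Q″ ≡ abs z Q′
  fresh-close {z = z} {P} {P′} {Q} {Q′} t u L with fresh (z ∷ L ++ fn P ++ fn Q)
  ... | w , w∉ =
    w , _ , _ , w∉ ∘ there ∘ ∈-++⁺ˡ , refresh-bout t w∉P , refresh-in u w∉Q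
      , abs-swap z w P′ (w∉P ∘ bound-fn refl t z≢w ∘ proj₁ ∘ fn-abs⁻ P′)
      , abs-swap z w Q′ (w∉Q ∘ bound-fn refl u z≢w ∘ proj₁ ∘ fn-abs⁻ Q′)
    where
    w∉P : w ∉ fn P
    w∉P = w∉ ∘ there ∘ ∈-++⁺ʳ L ∘ ∈-++⁺ˡ

    w∉Q : w ∉ fn Q
    w∉Q = w∉ ∘ there ∘ ∈-++⁺ʳ L ∘ ∈-++⁺ʳ (fn P)

    z≢w : z ≢ w
    z≢w refl = w∉ (here refl)

  -- `S-Open` announces the name with which the restriction is presented; here the announced name is
  -- an arbitrary fresh `z`.
  S-Open′ : ∀ {a x z P P′} → P —[ a ⟨ x ⟩ ]→ P′ → x ≢ a → z ∉ fn (ν[ x ] P) →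
            ν[ x ] P —[ a ⟨ν z ⟩ ]→ ren (swap x z) P′
  S-Open′ t x≢a z∉ = refresh-bout (S-Open t x≢a) z∉

  -- The origins of a step of `ν[ x ] P` with the presentation by `x` held fixed. In `via-open` the
  -- name `x` is extruded under the name `z`, hence the transposition in the derivative.
  data ResStep (x : Name) (P : Process) : Action → Process → Set where
    via-res  : ∀ {α P′} → P —[ α ]→ P′ → x ∉ n⟦ α ⟧ → ResStep x P α (ν[ x ] P′)
    via-open : ∀ {a z P′} → P —[ a ⟨ x ⟩ ]→ P′ → x ≢ a → z ∉ fn (ν[ x ] P) →
               ResStep x P (a ⟨ν z ⟩) (ren (swap x z) P′)

  -- The last rule may have used another name `z` and body `P₁`. By `abs-≡`, `P` is `P₁` with `z`
  -- and `x` exchanged, so the premise is carried along that transposition. In the `S-Res` case the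
  -- label survives because it mentions neither name.
  res-inv : ∀ {x P α R} → ν[ x ] P —[ α ]→ R → x ∉ bn α → ResStep x P α R
  res-inv {x} {P} {α} t x∉bn = invert t refl
    where
    x∉n : x ∉ n⟦ α ⟧
    x∉n m = [ z∉abs P ∘ step-fa t , x∉bn ]′ (n⇒fa⊎bn α m)

    -- The source is generalised to `S` with an equation, since `ν[ x ] P` contains a call of `abs`
    -- and cannot be unified with the conclusions of the rules.
    invert : ∀ {S R} → S —[ α ]→ R → S ≡ ν[ x ] P → ResStep x P α R
    invert (S-Res {z = z} {P₁} {P₁′} t₁ z∉) e =
      subst (ResStep x P α) (cong res (abs-swap z x P₁′ x∉)) (via-res t′ x∉n)
      where
      e′ : abs z P₁ ≡ abs x P
      e′ = res-injective e
      t′ = step-≡ (sym (abs-≡ x z (sym e′)))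
             (renAct-fixed α (λ m → swap-other (λ { refl → z∉ m }) (λ { refl → x∉n m })))
             refl (step-ren (swap-injective z x) t₁)
      x∉ : x ∉ fn (abs z P₁′)
      x∉ m with k , z≢x ← fn-abs⁻ P₁′ m with step-fn t₁ k
      ... | inj₂ l = x∉bn l
      ... | inj₁ l = z∉abs P (subst (λ B → x ∈ fn B) e′ (fn-abs⁺ P₁ l z≢x))
    invert (S-Open {a} {z} {P₁} {P₁′} t₁ z≢a) e =
      -- The transported premise outputs `x`. Its `via-open` derivative transposes `x` and `z` a
      -- second time and so is `P₁′` again.
      subst (ResStep x P α)
        (trans (ren-≗ P₁′ (λ _ → swap-sym x z _)) (ren-swap-swap z x P₁′))
        (via-open t′ (λ { refl → x∉n (here refl) })
          (λ m → z∉abs P₁ (subst (λ B → z ∈ fn B) (sym e′) m)))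
      where
      e′ : abs z P₁ ≡ abs x P
      e′ = res-injective e
      t′ = step-≡ (sym (abs-≡ x z (sym e′)))
             (cong₂ _⟨_⟩ (swap-other z≢a (λ { refl → x∉n (here refl) })) (swap-l z x))
             refl (step-ren (swap-injective z x) t₁)

-- Structural congruence: free names and closure under renaming.

module Congruence (𝒩 : Names) where

  open π-Calculus 𝒩
  open Renaming 𝒩

  ≅-reflexive : ∀ {P Q} → P ≡ Q → P ≅ Q
  ≅-reflexive refl = ≅-refl

  -- Carries the freshness premises of the rules across `≅`. Both inclusions are proved together so
  -- that `≅-sym` merely exchanges them.
  fn-≅ : ∀ {P Q} → P ≅ Q → fn P ⊆ fn Q × fn Q ⊆ fn P
  fn-≅ ≅-refl = id , id
  fn-≅ (≅-sym p) with f , g ← fn-≅ p = g , f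
  fn-≅ (≅-trans p q) with f , g ← fn-≅ p | h , k ← fn-≅ q = h ∘ f , g ∘ k
  fn-≅ (in-cong {y = y} {P} {Q} p) with f , g ← fn-≅ p =
    ++⁺ʳ (_ ∷ []) (abs-⊆ {P = P} {Q} f) , ++⁺ʳ (_ ∷ []) (abs-⊆ {P = Q} {P} g)
  fn-≅ (out-cong p) with f , g ← fn-≅ p = ++⁺ʳ (_ ∷ _ ∷ []) f , ++⁺ʳ (_ ∷ _ ∷ []) g
  fn-≅ (par-cong p q) with f , g ← fn-≅ p | h , k ← fn-≅ q = ++⁺ f h , ++⁺ g k
  fn-≅ (res-cong {P = P} {Q} p) with f , g ← fn-≅ p = abs-⊆ {P = P} {Q} f , abs-⊆ {P = Q} {P} g
  fn-≅ (rep-cong p) = fn-≅ p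
  fn-≅ (par-assoc {P} {Q} {R}) rewrite ++-assoc (fn P) (fn Q) (fn R) = id , id
  fn-≅ (par-unit {P}) rewrite ++-identityʳ (fn P) = id , id
  fn-≅ (par-comm {P} {Q}) = comm P Q , comm Q P
    where
    comm : ∀ P Q → fn (P ∣ Q) ⊆ fn (Q ∣ P)
    comm P Q = [ ∈-++⁺ʳ (fn Q) , ∈-++⁺ˡ ]′ ∘ ∈-++⁻ (fn P)
  fn-≅ res-nil = id , id
  fn-≅ (res-par {x} {P} {Q} x∉) =
    ++⁺ʳ (fn (abs x P)) (λ m → fn-abs⁺ Q m (λ { refl → x∉ m })) ,
    ++⁺ʳ (fn (abs x P)) (proj₁ ∘ fn-abs⁻ Q)
  fn-≅ (res-swap {x} {y} {P}) = swap-⊆ x y , swap-⊆ y x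
    where
    swap-⊆ : ∀ x y → fn (ν[ x ] ν[ y ] P) ⊆ fn (ν[ y ] ν[ x ] P)
    swap-⊆ x y m with m′ , x≢ ← fn-abs⁻ (ν[ y ] P) m with m″ , y≢ ← fn-abs⁻ P m′ =
      fn-abs⁺ (ν[ x ] P) (fn-abs⁺ P m″ x≢) y≢
  fn-≅ (rep-unfold {P}) = ∈-++⁺ˡ , [ id , id ]′ ∘ ∈-++⁻ (fn P)

  upd : (Name → Name) → Name → Name → Name → Name
  upd σ z w x = if does (z ≟ x) then w else σ x

  upd-hit : ∀ σ z w → upd σ z w z ≡ w
  upd-hit σ z w with z ≟ z
  ... | yes _  = refl
  ... | no z≢z = contradiction refl z≢z

  upd-miss : ∀ σ {z w x} → z ≢ x → upd σ z w x ≡ σ x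
  upd-miss σ {z} {x = x} z≢x with z ≟ x
  ... | yes z≡x = contradiction z≡x z≢x
  ... | no _    = refl

  upd-comm : ∀ σ {z w z′ w′} → z ≢ z′ → ∀ x → upd (upd σ z w) z′ w′ x ≡ upd (upd σ z′ w′) z w x
  upd-comm σ {z} {z′ = z′} z≢z′ x with z ≟ x | z′ ≟ x
  ... | yes refl | yes refl = contradiction refl z≢z′
  ... | yes _    | no _     = refl
  ... | no _     | yes _    = refl
  ... | no _     | no _     = refl

  -- Under the binder, `σ` alone could identify `z` with another name; redirecting `z` to a `w`
  -- outside the image keeps the bound occurrences apart.
  abs-upd : ∀ {n} σ {z w} (P : Proc n) → w ∉ fn (ren σ P) →
            abs w (ren (upd σ z w) P) ≡ ren σ (abs z P)
  abs-upd σ {z} {w} P w∉ = abs-ren (upd-hit σ z w) P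
    (λ x∈ z≢x → upd-miss σ z≢x , λ { refl → w∉ (fn-ren⁺ P x∈) })

  -- Needed for every `σ`, since communication substitutes names that may already occur. The binder
  -- cases use the induction hypothesis at `σ` updated with a fresh target for the bound name.
  ren-≅ : ∀ {P Q} → P ≅ Q → ∀ σ → ren σ P ≅ ren σ Q
  ren-≅ ≅-refl σ        = ≅-refl
  ren-≅ (≅-sym p) σ     = ≅-sym (ren-≅ p σ)
  ren-≅ (≅-trans p q) σ = ≅-trans (ren-≅ p σ) (ren-≅ q σ)
  ren-≅ (in-cong {x} {y} {P} {Q} p) σ with fresh (fn (ren σ P) ++ fn (ren σ Q))
  ... | w , w∉ = subst₂ (λ B C → inp (name (σ x)) B ≅ inp (name (σ x)) C)
    (abs-upd σ P (w∉ ∘ ∈-++⁺ˡ)) (abs-upd σ Q (w∉ ∘ ∈-++⁺ʳ (fn (ren σ P))))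
    (in-cong {σ x} {w} (ren-≅ p (upd σ y w)))
  ren-≅ (out-cong p) σ   = out-cong (ren-≅ p σ)
  ren-≅ (par-cong p q) σ = par-cong (ren-≅ p σ) (ren-≅ q σ)
  ren-≅ (res-cong {x} {P} {Q} p) σ with fresh (fn (ren σ P) ++ fn (ren σ Q))
  ... | w , w∉ = subst₂ (λ B C → res B ≅ res C)
    (abs-upd σ P (w∉ ∘ ∈-++⁺ˡ)) (abs-upd σ Q (w∉ ∘ ∈-++⁺ʳ (fn (ren σ P))))
    (res-cong {w} (ren-≅ p (upd σ x w)))
  ren-≅ (rep-cong p) σ = rep-cong (ren-≅ p σ)
  ren-≅ par-assoc σ    = par-assoc
  ren-≅ par-unit σ     = par-unit
  ren-≅ par-comm σ     = par-comm
  ren-≅ (res-nil {x}) σ = res-nil {x}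
  ren-≅ (res-par {x} {P} {Q} x∉) σ with fresh (fn (ren σ P) ++ fn (ren σ Q))
  ... | w , w∉ = subst₂ (λ B C → res B ∣ ren σ Q ≅ res C)
    (abs-upd σ P (w∉ ∘ ∈-++⁺ˡ))
    (trans (cong (λ S → abs w (ren (upd σ x w) P ∣ S))
             (ren-cong Q (λ m → sym (upd-miss σ (λ { refl → x∉ m })))))
           (abs-upd σ (P ∣ Q) w∉))
    (res-par (w∉ ∘ ∈-++⁺ʳ (fn (ren σ P))))
  ren-≅ (res-swap {x} {y} {P}) σ with x ≟ y
  ... | yes refl = ≅-refl
  ... | no x≢y with fresh (fn (ren σ P))
  ...   | w , w∉ with fresh (w ∷ fn (ren σ P))
  ...     | v , v∉ =
    subst₂ (λ B C → res B ≅ res C)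
      (twice x≢y (v∉ ∘ here) (λ m → w∉ m) (λ m → v∉ (there m)))
      -- On this side `y` is the outer binder, so the two updates have to be exchanged before
      -- `twice` applies.
      (trans (cong (λ S → abs v (ν[ w ] S)) (ren-cong P (λ {u} _ → upd-comm σ x≢y u)))
        (twice (≢-sym x≢y) (v∉ ∘ here ∘ sym) (λ m → v∉ (there m)) (λ m → w∉ m)))
      (res-swap {w} {v} {ren (upd (upd σ x w) y v) P})
    where
    twice : ∀ {a b c d} → a ≢ b → d ≢ c → c ∉ fn (ren σ P) → d ∉ fn (ren σ P) →
            abs c (ν[ d ] ren (upd (upd σ a c) b d) P) ≡ ren σ (abs a (ν[ b ] P))
    twice {a} {b} {c} {d} a≢b d≢c c∉ d∉ =
      trans (cong (abs c ∘ res) (abs-upd (upd σ a c) P d∉′)) (abs-upd σ (ν[ b ] P) c∉′)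
      where
      d∉′ : d ∉ fn (ren (upd σ a c) P)
      d∉′ m with u , u∈ , e ← fn-ren⁻ P m with a ≟ u
      ... | yes _ = d≢c e
      ... | no _  = d∉ (subst (_∈ _) (sym e) (fn-ren⁺ P u∈))
      c∉′ : c ∉ fn (ren σ (ν[ b ] P))
      c∉′ m with u , u∈ , refl ← fn-ren⁻ (ν[ b ] P) m = c∉ (fn-ren⁺ P (proj₁ (fn-abs⁻ P u∈)))
  ren-≅ rep-unfold σ = rep-unfold

  subst-≅ : ∀ {P Q y z} → P ≅ Q → P [ y / z ] ≅ Q [ y / z ]
  subst-≅ {P} {Q} {y} {z} p =
    subst₂ _≅_ (sym (subst-sub P)) (sym (subst-sub Q)) (ren-≅ p (sub y z))

-- Matching of transitions across structural congruence.

module Harmony (𝒩 : Names) where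

  open π-Calculus 𝒩
  open Renaming 𝒩
  open Transitions 𝒩
  open Congruence 𝒩

  Match : Process → Action → Process → Set
  Match Q α P′ = ∃[ Q′ ] (Q —[ α ]→ Q′ × P′ ≅ Q′)

  -- A one-step notion: derivatives are compared by `≅`, not by `Sim` again, so each axiom becomes a
  -- finite case analysis.
  Sim : Process → Process → Set
  Sim P Q = ∀ {α P′} → P —[ α ]→ P′ → Match Q α P′

  match-≡ : ∀ {P Q α P′} → P ≡ Q → Match P α P′ → Match Q α P′
  match-≡ refl m = m

  sim-trans : ∀ {P Q R} → Sim P Q → Sim Q R → Sim P R
  sim-trans f g t with _ , t₁ , p ← f t with _ , t₂ , q ← g t₁ = _ , t₂ , ≅-trans p q

  ∉-head : ∀ {z} {L : List Name} → z ∉ L → ∀ {u} → u ∈ z ∷ [] → u ∉ L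
  ∉-head z∉ (here refl) = z∉

  avoid : ∀ {P Q α} → P ≅ Q → (∀ {z} → z ∈ bn α → z ∉ fn P) →
          ∀ {z} → z ∈ bn α → z ∉ fn Q
  avoid p f m = f m ∘ proj₂ (fn-≅ p)

  -- The label may bind any fresh `z`. The derivative is then `P` with `y` and `z` exchanged, and
  -- `Q` under the same exchange answers it.
  sim-in : ∀ {x y P Q} → P ≅ Q → Sim (x ⦅ y ⦆∙ P) (x ⦅ y ⦆∙ Q)
  sim-in {x} {y} {P} {Q} p t = invert t refl
    where
    inp-injective : ∀ {a B C} → inp a B ≡ inp (name x) C → a ≡ name x × B ≡ C
    inp-injective refl = refl , refl

    invert : ∀ {S α R} → S —[ α ]→ R → S ≡ x ⦅ y ⦆∙ P → Match (x ⦅ y ⦆∙ Q) α R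
    invert (S-In {z = z} {P₁} z∉) e with refl , e′ ← inp-injective e =
      _ ,
      step-≡ (cong (inp (name x)) B≡) refl refl
        (S-In (subst (λ B → z ∉ fn (inp (name x) B)) (sym B≡) z∉′)) ,
      ≅-trans (≅-reflexive (abs-≡ z y e′)) (ren-≅ p (swap y z))
      where
      z∉′ : z ∉ fn (x ⦅ y ⦆∙ Q)
      z∉′ = z∉ ∘ subst (λ B → z ∈ fn (inp (name x) B)) (sym e′)
               ∘ proj₂ (fn-≅ (in-cong {x} {y} p))
      B≡ : abs z (ren (swap y z) Q) ≡ abs y Q
      B≡ = abs-swap y z Q (z∉′ ∘ there)

  sim-out : ∀ {x y P Q} → P ≅ Q → Sim (x ⟨ y ⟩∙ P) (x ⟨ y ⟩∙ Q)
  sim-out p S-Out = _ , S-Out , p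

  sim-par : ∀ {P P₁ Q Q₁} → P ≅ P₁ → Q ≅ Q₁ → Sim P P₁ → Sim Q Q₁ →
            Sim (P ∣ Q) (P₁ ∣ Q₁)
  sim-par p q f g (S-Par-L {α} t h) with _ , t′ , p′ ← f t =
    _ , S-Par-L t′ (avoid {α = α} q h) , par-cong p′ q
  sim-par p q f g (S-Par-R {α} u h) with _ , u′ , q′ ← g u =
    _ , S-Par-R u′ (avoid {α = α} p h) , par-cong p q′
  sim-par p q f g (S-Com-L t u) with _ , t′ , p′ ← f t | _ , u′ , q′ ← g u =
    _ , S-Com-L t′ u′ , par-cong p′ (subst-≅ q′)
  sim-par p q f g (S-Com-R t u) with _ , t′ , p′ ← f t | _ , u′ , q′ ← g u =
    _ , S-Com-R t′ u′ , par-cong (subst-≅ p′) q′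
  sim-par p q f g (S-Close-L t u) with _ , t′ , p′ ← f t | _ , u′ , q′ ← g u =
    _ , S-Close-L t′ u′ , res-cong (par-cong p′ q′)
  sim-par p q f g (S-Close-R t u) with _ , t′ , p′ ← f t | _ , u′ , q′ ← g u =
    _ , S-Close-R t′ u′ , res-cong (par-cong p′ q′)

  sim-rep : ∀ {P Q} → P ≅ Q → Sim P Q → Sim (! P) (! Q)
  sim-rep p f (S-Rep t) with _ , t′ , p′ ← f t =
    _ , S-Rep t′ , par-cong p′ (rep-cong p)
  sim-rep p f (S-Rep-Com t u) with _ , t′ , p′ ← f t | _ , u′ , q′ ← f u =
    _ , S-Rep-Com t′ u′ , par-cong (par-cong p′ (subst-≅ q′)) (rep-cong p)
  sim-rep p f (S-Rep-Close t u) with _ , t′ , p′ ← f t | _ , u′ , q′ ← f u =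
    _ , S-Rep-Close t′ u′ , par-cong (res-cong (par-cong p′ q′)) (rep-cong p)

  sim-comm : ∀ {P Q} → Sim (P ∣ Q) (Q ∣ P)
  sim-comm (S-Par-L t f)   = _ , S-Par-R t f , par-comm
  sim-comm (S-Par-R t f)   = _ , S-Par-L t f , par-comm
  sim-comm (S-Com-L t u)   = _ , S-Com-R u t , par-comm
  sim-comm (S-Com-R t u)   = _ , S-Com-L u t , par-comm
  sim-comm (S-Close-L t u) = _ , S-Close-R u t , res-cong par-comm
  sim-comm (S-Close-R t u) = _ , S-Close-L u t , res-cong par-comm

  sim-unit : ∀ {P} → Sim (P ∣ 𝟎) P
  sim-unit (S-Par-L t _) = _ , t , par-unit

  sim-unit⁻¹ : ∀ {P} → Sim P (P ∣ 𝟎)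
  sim-unit⁻¹ t = _ , S-Par-L t (λ _ ()) , ≅-sym par-unit

  res-par-r : ∀ {x P Q} → x ∉ fn P → P ∣ ν[ x ] Q ≅ ν[ x ] (P ∣ Q)
  res-par-r x∉ = ≅-trans par-comm (≅-trans (res-par x∉) (res-cong par-comm))

  -- Regrouping can bring the bound name of an input or bound output next to a component where it
  -- occurs free; in those cases it is refreshed first. Elsewhere the side conditions already supply
  -- the freshness that `subst-∉` and `res-par` require.
  sim-assoc : ∀ {P Q R} → Sim (P ∣ (Q ∣ R)) ((P ∣ Q) ∣ R)
  sim-assoc {Q = Q} (S-Par-L t f) =
    _ , S-Par-L (S-Par-L t (λ m → f m ∘ ∈-++⁺ˡ)) (λ m → f m ∘ ∈-++⁺ʳ (fn Q)) , par-assoc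
  sim-assoc (S-Par-R (S-Par-L t g) f) = _ , S-Par-L (S-Par-R t f) g , par-assoc
  sim-assoc {P} (S-Par-R (S-Par-R t g) f) =
    _ , S-Par-R t (λ m → [ f m , g m ]′ ∘ ∈-++⁻ (fn P)) , par-assoc
  sim-assoc (S-Par-R (S-Com-L t u) f) = _ , S-Com-L (S-Par-R t (λ ())) u , par-assoc
  sim-assoc {P} (S-Par-R (S-Com-R {y = y} t u) f)
    with w , _ , w∉ , t′ , e ← fresh-in t (fn P) =
    _ , S-Com-R (S-Par-R t′ (∉-head w∉)) u ,
    ≅-trans par-assoc
      (par-cong (par-cong (≅-reflexive (sym (subst-∉ P w∉))) (≅-reflexive (sym (e y)))) ≅-refl)
  sim-assoc {P} (S-Par-R (S-Close-L t u) f)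
    with w , _ , _ , w∉ , t′ , u′ , e , e′ ← fresh-close t u (fn P) =
    _ , S-Close-L (S-Par-R t′ (∉-head w∉)) u′ ,
    ≅-trans (≅-reflexive (cong (λ B → P ∣ res B) (sym (cong₂ _∣_ e e′))))
      (≅-trans (res-par-r w∉) (res-cong par-assoc))
  sim-assoc {P} (S-Par-R (S-Close-R t u) f)
    with w , _ , _ , w∉ , u′ , t′ , e′ , e ← fresh-close u t (fn P) =
    _ , S-Close-R (S-Par-R t′ (∉-head w∉)) u′ ,
    ≅-trans (≅-reflexive (cong (λ B → P ∣ res B) (sym (cong₂ _∣_ e e′))))
      (≅-trans (res-par-r w∉) (res-cong par-assoc))
  sim-assoc {R = R} (S-Com-L t (S-Par-L u g)) =
    _ , S-Par-L (S-Com-L t u) (λ ()) ,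
    ≅-trans par-assoc (≅-reflexive (cong (_ ∣_) (subst-∉ R (g (here refl)))))
  sim-assoc {Q = Q} (S-Com-L t (S-Par-R u g)) =
    _ , S-Com-L (S-Par-L t (λ ())) u ,
    ≅-trans par-assoc
      (≅-reflexive (cong (λ S → (_ ∣ S) ∣ _) (subst-∉ Q (g (here refl)))))
  sim-assoc (S-Com-R t (S-Par-L u g)) = _ , S-Par-L (S-Com-R t u) (λ ()) , par-assoc
  sim-assoc {Q = Q} (S-Com-R {y = y} t (S-Par-R u g))
    with w , _ , w∉ , t′ , e ← fresh-in t (fn Q) =
    _ , S-Com-R (S-Par-L t′ (∉-head w∉)) u ,
    ≅-trans par-assoc
      (par-cong (par-cong (≅-reflexive (sym (e y))) (≅-reflexive (sym (subst-∉ Q w∉)))) ≅-refl)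
  sim-assoc (S-Close-L t (S-Par-L u g)) =
    _ , S-Par-L (S-Close-L t u) (λ ()) ,
    ≅-trans (res-cong par-assoc) (≅-sym (res-par (g (here refl))))
  sim-assoc (S-Close-L t (S-Par-R u g)) =
    _ , S-Close-L (S-Par-L t (∉-head (g (here refl)))) u , res-cong par-assoc
  sim-assoc (S-Close-R t (S-Par-L u g)) =
    _ , S-Par-L (S-Close-R t u) (λ ()) ,
    ≅-trans (res-cong par-assoc) (≅-sym (res-par (g (here refl))))
  sim-assoc (S-Close-R t (S-Par-R u g)) =
    _ , S-Close-R (S-Par-L t (∉-head (g (here refl)))) u , res-cong par-assoc

  -- `sim-assoc` conjugated by commutations, through `R ∣ (Q ∣ P)` and `(R ∣ Q) ∣ P`.
  sim-assoc⁻¹ : ∀ {P Q R} → Sim ((P ∣ Q) ∣ R) (P ∣ (Q ∣ R))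
  sim-assoc⁻¹ {P} {Q} {R} = sim-trans {(P ∣ Q) ∣ R} sim-comm
    (sim-trans {R ∣ (P ∣ Q)} {R ∣ (Q ∣ P)}
      (sim-par ≅-refl par-comm (λ t → _ , t , ≅-refl) sim-comm)
      (sim-trans {R ∣ (Q ∣ P)} sim-assoc
        (sim-trans {(R ∣ Q) ∣ P} sim-comm
          (sim-par ≅-refl par-comm (λ t → _ , t , ≅-refl) sim-comm))))

  -- Unfolding of replication.

  sim-unfold : ∀ {P} → Sim (! P) (P ∣ ! P)
  sim-unfold (S-Rep t) = _ , S-Par-L t (step-bn t) , ≅-refl
  sim-unfold {P} (S-Rep-Com t u) =
    _ , S-Com-L t (S-Rep u) ,
    ≅-trans (≅-sym par-assoc)
      (par-cong ≅-refl (par-cong ≅-refl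
        (≅-reflexive (sym (subst-∉ (! P) (step-bn u (here refl)))))))
  sim-unfold (S-Rep-Close t u) =
    _ , S-Close-L t (S-Rep u) ,
    ≅-trans (res-par (step-bn u (here refl))) (res-cong (≅-sym par-assoc))

  par-swap-left : ∀ {P Q R} → P ∣ (Q ∣ R) ≅ Q ∣ (P ∣ R)
  par-swap-left =
    ≅-trans par-assoc (≅-trans (par-cong par-comm ≅-refl) (≅-sym par-assoc))

  -- Folds an idle unfolded copy back into the replication.
  absorb : ∀ {P Q} → P ∣ (Q ∣ ! P) ≅ Q ∣ ! P
  absorb = ≅-trans par-swap-left (par-cong ≅-refl (≅-sym rep-unfold))

  sim-unfold⁻¹ : ∀ {P} → Sim (P ∣ ! P) (! P)
  sim-unfold⁻¹ (S-Par-L t f) = _ , S-Rep t , ≅-refl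
  -- The same step of `! P` is the answer; the split on its last rule exposes the `! P` in the
  -- derivative.
  sim-unfold⁻¹ (S-Par-R t@(S-Rep _) f)         = _ , t , absorb
  sim-unfold⁻¹ (S-Par-R t@(S-Rep-Com _ _) f)   = _ , t , absorb
  sim-unfold⁻¹ (S-Par-R t@(S-Rep-Close _ _) f) = _ , t , absorb
  sim-unfold⁻¹ {P} (S-Com-L t (S-Rep u)) =
    _ , S-Rep-Com t u ,
    ≅-trans
      (par-cong ≅-refl (par-cong ≅-refl
        (≅-reflexive (subst-∉ (! P) (step-bn u (here refl))))))
      par-assoc
  -- `S-Rep-Com` puts the sender first, whereas here the receiver is on the left.
  sim-unfold⁻¹ (S-Com-R t (S-Rep u)) =
    _ , S-Rep-Com u t , ≅-trans par-swap-left par-assoc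
  sim-unfold⁻¹ (S-Close-L t (S-Rep u)) =
    _ , S-Rep-Close t u ,
    ≅-trans (res-cong par-assoc) (≅-sym (res-par (step-bn u (here refl))))
  sim-unfold⁻¹ (S-Close-R t (S-Rep u)) =
    _ , S-Rep-Close u t ,
    ≅-trans (res-cong (≅-trans par-swap-left par-assoc))
      (≅-sym (res-par (step-bn u (here refl))))

  -- α-conversion makes the restricted name fresh for the action, which is
  -- what res-inv asks for.
  ν-α : ∀ {x w} P → w ∉ fn P → ν[ w ] ren (swap x w) P ≡ ν[ x ] P
  ν-α {x} {w} P w∉ = cong res (abs-swap x w P (w∉ ∘ proj₁ ∘ fn-abs⁻ P))

  -- Conjugation: the step is transposed back, answered, and the answer transposed again.
  sim-ren : ∀ {a b P Q} → Sim P Q → Sim (ren (swap a b) P) (ren (swap a b) Q)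
  sim-ren {a} {b} {P} f {α} {P′} t
    with Q′ , t′ , p ← f (step-≡ (ren-swap-swap a b P) refl refl
                            (step-ren (swap-injective a b) t)) =
    ren (swap a b) Q′ ,
    step-≡ refl (renAct-swap-swap a b α) refl (step-ren (swap-injective a b) t′) ,
    ≅-trans (≅-reflexive (sym (ren-swap-swap a b P′))) (ren-≅ p (swap a b))

  sim-res : ∀ {x P Q} → P ≅ Q → Sim P Q → Sim (ν[ x ] P) (ν[ x ] Q)
  sim-res {x} {P} {Q} p f {α} {R} t with fresh (bn α ++ fn P ++ fn Q)
  ... | w , w∉ =
    match-≡ (ν-α Q (w∉ ∘ ∈-++⁺ʳ (bn α) ∘ ∈-++⁺ʳ (fn P)))
      (go (ren-≅ p (swap x w)) (sim-ren f)
        (step-≡ (sym (ν-α P (w∉ ∘ ∈-++⁺ʳ (bn α) ∘ ∈-++⁺ˡ))) refl refl t)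
        (w∉ ∘ ∈-++⁺ˡ))
    where
    go : ∀ {x P Q α R} → P ≅ Q → Sim P Q → ν[ x ] P —[ α ]→ R → x ∉ bn α →
         Match (ν[ x ] Q) α R
    go p f t x∉ with res-inv t x∉
    ... | via-res t′ x∉n with _ , u , q ← f t′ = _ , S-Res u x∉n , res-cong q
    ... | via-open {z = z} t′ x≢a z∉ with _ , u , q ← f t′ =
      _ , S-Open′ u x≢a (z∉ ∘ proj₂ (fn-≅ (res-cong p))) , ren-≅ q (swap _ z)

  sim-nil : ∀ {x} → Sim (ν[ x ] 𝟎) 𝟎
  sim-nil {x} {α} t with fresh (bn α)
  ... | w , w∉ with res-inv {w} {𝟎} t w∉
  ...   | via-res () _
  ...   | via-open () _ _

  sim-nil⁻¹ : ∀ {x} → Sim 𝟎 (ν[ x ] 𝟎)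
  sim-nil⁻¹ ()

  -- Scope extension.

  S-Res′ : ∀ {α z P P′} → P —[ α ]→ P′ → z ∉ fa α → z ∉ bn α →
           ν[ z ] P —[ α ]→ ν[ z ] P′
  S-Res′ {α} t z∉fa z∉bn = S-Res t (λ m → [ z∉fa , z∉bn ]′ (n⇒fa⊎bn α m))

  ∉-com : ∀ {a x y z Q Q′} → Q —[ a ⦅ z ⦆ ]→ Q′ → x ∉ fn Q → x ≢ y →
          x ∉ fn (Q′ [ y / z ])
  ∉-com {Q′ = Q′} u x∉ x≢y m with fn-subst Q′ m
  ... | inj₁ x≡y         = x≢y x≡y
  ... | inj₂ (m′ , z≢x) = x∉ (bound-fn refl u z≢x m′)

  ∉-bound : ∀ {α x z Q Q′} → bn α ≡ z ∷ [] → Q —[ α ]→ Q′ → x ∉ fn Q → z ≢ x → x ∉ fn Q′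
  ∉-bound e u x∉ z≢x = x∉ ∘ bound-fn e u z≢x

  ∉-step : ∀ {α x Q Q′} → Q —[ α ]→ Q′ → x ∉ fn Q → x ∉ bn α → x ∉ fn Q′
  ∉-step u x∉ x∉bn m = [ x∉ , x∉bn ]′ (step-fn u m)

  subst-ν : ∀ {x y z} P → z ≢ x → x ≢ y → (ν[ x ] P) [ y / z ] ≡ ν[ x ] (P [ y / z ])
  subst-ν {x} {y} {z} P z≢x x≢y =
    trans (subst-sub (ν[ x ] P))
      (cong res (trans (sym (abs-ren (sub-miss z≢x) P (λ {u} _ x≢u → refl , ∉sub u x≢u)))
                       (cong (abs x) (sym (subst-sub P)))))
    where
    ∉sub : ∀ u → x ≢ u → x ≢ sub y z u
    ∉sub u x≢u e with sub-dec {y} {z} u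
    ... | inj₁ (_ , e′) = x≢y (trans e e′)
    ... | inj₂ (_ , e′) = x≢u (trans e e′)

  -- Under scope extrusion, an S-Close of an opened x on one side is matched
  -- by an S-Com of the free name x on the other.
  close≡com : ∀ {x w} P Q → x ∉ fn Q → w ∉ fn P → x ≢ w →
              ν[ w ] (ren (swap x w) P ∣ Q) ≡ ν[ x ] (P ∣ (Q [ x / w ]))
  close≡com {x} {w} P Q x∉ w∉ x≢w =
    trans
      -- As `x` is fresh for `Q`, `Q` is the transposition of `Q [ x / w ]`. Both components then
      -- carry the same transposition, which is an α-conversion of the restriction.
      (cong (λ S → ν[ w ] (ren (swap x w) P ∣ S))
        (trans (sym (ren-swap-swap x w Q)) (cong (ren (swap x w)) (swap-sub Q x∉))))
      (ν-α (P ∣ (Q [ x / w ])) ([ w∉ , w∉Q ]′ ∘ ∈-++⁻ (fn P)))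
    where
    w∉Q : w ∉ fn (Q [ x / w ])
    w∉Q m with fn-subst Q m
    ... | inj₁ refl      = x≢w refl
    ... | inj₂ (_ , w≢w) = w≢w refl

  ∉⇒≢ : ∀ {x y : Name} {L} → x ∉ y ∷ L → x ≢ y
  ∉⇒≢ x∉ refl = x∉ (here refl)

  -- A step that leaves the restriction in place is followed by `S-Res` outside. If `x` is opened,
  -- `S-Par-L` gives an `S-Open` of the whole, and `S-Close-L` becomes a communication of the free
  -- name `x` below the restriction.
  extrude : ∀ {x P Q α R} → (ν[ x ] P) ∣ Q —[ α ]→ R → x ∉ bn α → x ∉ fn Q →
            Match (ν[ x ] (P ∣ Q)) α R
  extrude {x} {P} {Q} (S-Par-L {α} t f) x∉ x∉Q with res-inv t x∉
  ... | via-res t′ x∉n = _ , S-Res (S-Par-L t′ f) x∉n , res-par x∉Q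
  ... | via-open {z = z} {P′} t′ x≢a z∉ =
    _ ,
    S-Open′ (S-Par-L t′ (λ ())) x≢a
      ([ z∉ , f (here refl) ∘ proj₁ ∘ fn-abs⁻ Q ]′ ∘ ∈-++⁻ (fn (ν[ x ] P))) ,
    par-cong ≅-refl (≅-reflexive (sym (ren-swap-∉ Q x∉Q (f (here refl)))))
  extrude {x} {P} (S-Par-R u f) x∉ x∉Q =
    _ ,
    S-Res′ (S-Par-R u (λ m k → f m (fn-abs⁺ P k (λ { refl → x∉ m })))) (x∉Q ∘ step-fa u) x∉ ,
    res-par (∉-step u x∉Q x∉)
  extrude {x} {P} (S-Com-L {y = y} t u) x∉ x∉Q with res-inv t (λ ())
  ... | via-res t′ _ =
    _ , S-Res (S-Com-L t′ u) (λ ()) ,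
    res-par (∉-com u x∉Q (λ { refl → z∉abs P (step-fa t (there (here refl))) }))
  extrude {x} (S-Com-R {y = y} t u) x∉ x∉Q
    with w , _ , w∉ , t′ , e ← fresh-in t (x ∷ [])
    with via-res {P′ = P′} t″ _ ← res-inv t′ (∉-singleton (≢-sym (∉⇒≢ w∉))) =
    _ , S-Res (S-Com-R t″ u) (λ ()) ,
    ≅-trans
      (par-cong (≅-reflexive (trans (sym (e y))
                  (subst-ν P′ (∉⇒≢ w∉) (λ { refl → x∉Q (step-fa u (there (here refl))) }))))
                ≅-refl)
      (res-par (x∉Q ∘ out-fn u))
  extrude {x} {P} (S-Close-L t u) x∉ x∉Q
    with w , _ , Q″ , w∉ , t′ , u′ , e , e′ ← fresh-close t u (x ∷ [])
    with res-inv t′ (∉-singleton (≢-sym (∉⇒≢ w∉)))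
  ... | via-res t″ _ =
    _ , S-Res (S-Close-L t″ u′) (λ ()) ,
    ≅-trans (≅-reflexive (cong res (sym (cong₂ _∣_ e e′))))
      (≅-trans (res-cong (res-par (∉-bound refl u′ x∉Q (∉⇒≢ w∉)))) res-swap)
  ... | via-open {P′ = P′} t″ x≢a w∉νP =
    _ , S-Res (S-Com-L t″ u′) (λ ()) ,
    ≅-reflexive (trans (cong res (sym (cong₂ _∣_ e e′)))
      (close≡com P′ Q″ (∉-bound refl u′ x∉Q (∉⇒≢ w∉))
        (λ m → w∉νP (fn-abs⁺ P (out-fn t″ m) (≢-sym (∉⇒≢ w∉))))
        (≢-sym (∉⇒≢ w∉))))
  extrude {x} {P} (S-Close-R t u) x∉ x∉Q
    with w , _ , _ , w∉ , u′ , t′ , e′ , e ← fresh-close u t (x ∷ [])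
    with via-res t″ _ ← res-inv t′ (∉-singleton (≢-sym (∉⇒≢ w∉))) =
    _ , S-Res (S-Close-R t″ u′) (λ ()) ,
    ≅-trans (≅-reflexive (cong res (sym (cong₂ _∣_ e e′))))
      (≅-trans (res-cong (res-par (∉-bound refl u′ x∉Q (∉⇒≢ w∉)))) res-swap)

  intrude : ∀ {x P Q α R} → ν[ x ] (P ∣ Q) —[ α ]→ R → x ∉ bn α → x ∉ fn Q →
            Match ((ν[ x ] P) ∣ Q) α R
  intrude {x} {P} {Q} t x∉ x∉Q with res-inv {x} {P ∣ Q} t x∉
  ... | via-res (S-Par-L t f) x∉n =
    _ , S-Par-L (S-Res t x∉n) f , ≅-sym (res-par x∉Q)
  ... | via-res (S-Par-R u f) x∉n =
    _ , S-Par-R u (λ m → f m ∘ proj₁ ∘ fn-abs⁻ P) , ≅-sym (res-par (∉-step u x∉Q x∉))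
  ... | via-res (S-Com-L {a} {y} {P′ = P′} t u) _ with x ≟ y
  ...   | no x≢y =
    _ , S-Com-L (S-Res t λ { (here refl) → x∉Q (step-fa u (here refl))
                           ; (there (here e)) → x≢y e }) u ,
    ≅-sym (res-par (∉-com u x∉Q x≢y))
  -- The message is the restricted name itself, which leaves its scope in `(ν[ x ] P) ∣ Q`: the
  -- communication becomes a close under a fresh `w`.
  ...   | yes refl with w , Q″ , w∉ , u′ , e ← fresh-in u (x ∷ fn P) =
    _ ,
    S-Close-L (S-Open′ t (λ { refl → x∉Q (step-fa u (here refl)) })
                (w∉ ∘ there ∘ proj₁ ∘ fn-abs⁻ P)) u′ ,
    ≅-reflexive (trans (cong (λ S → ν[ x ] (P′ ∣ S)) (sym (e x)))
      (sym (close≡com P′ Q″ (∉-bound refl u′ x∉Q (∉⇒≢ w∉))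
             (w∉ ∘ there ∘ out-fn t) (≢-sym (∉⇒≢ w∉)))))
  intrude {x} {P} {Q} t x∉ x∉Q | via-res (S-Com-R {a} {y} t₁ u) _
    with w , P″ , w∉ , t′ , e ← fresh-in t₁ (x ∷ []) =
    _ ,
    S-Com-R (S-Res t′ λ { (here refl) → x∉Q (step-fa u (here refl))
                        ; (there (here refl)) → w∉ (here refl) }) u ,
    ≅-trans (≅-sym (res-par (x∉Q ∘ out-fn u)))
      (par-cong (≅-reflexive (trans (cong (λ S → ν[ x ] S) (sym (e y)))
                  (sym (subst-ν P″ (∉⇒≢ w∉)
                         (λ { refl → x∉Q (step-fa u (there (here refl))) })))))
                ≅-refl)
  intrude {x} {P} {Q} t x∉ x∉Q | via-res (S-Close-L t₁ u) _
    with w , _ , _ , w∉ , t′ , u′ , e , e′ ← fresh-close t₁ u (x ∷ []) =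
    _ ,
    S-Close-L (S-Res t′ λ { (here refl) → x∉Q (step-fa u (here refl))
                          ; (there (here refl)) → w∉ (here refl) }) u′ ,
    ≅-trans (res-cong (≅-reflexive (cong res (sym (cong₂ _∣_ e e′)))))
      (≅-trans res-swap (res-cong (≅-sym (res-par (∉-bound refl u′ x∉Q (∉⇒≢ w∉))))))
  intrude {x} {P} {Q} t x∉ x∉Q | via-res (S-Close-R t₁ u) _
    with w , _ , _ , w∉ , u′ , t′ , e′ , e ← fresh-close u t₁ (x ∷ []) =
    _ ,
    S-Close-R (S-Res t′ λ { (here refl) → x∉Q (step-fa u (here refl))
                          ; (there (here refl)) → w∉ (here refl) }) u′ ,
    ≅-trans (res-cong (≅-reflexive (cong res (sym (cong₂ _∣_ e e′)))))
      (≅-trans res-swap (res-cong (≅-sym (res-par (∉-bound refl u′ x∉Q (∉⇒≢ w∉))))))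
  intrude {x} {P} {Q} t x∉ x∉Q | via-open {z = z} (S-Par-L t₁ _) x≢a z∉ =
    _ , S-Par-L (S-Open′ t₁ x≢a (z∉ ∘ ∈-++⁺ˡ)) (∉-head z∉Q) ,
    par-cong ≅-refl (≅-reflexive (ren-swap-∉ Q x∉Q z∉Q))
    where
    z∉Q : z ∉ fn Q
    z∉Q m = z∉ (∈-++⁺ʳ (fn (ν[ x ] P)) (fn-abs⁺ Q m (λ { refl → x∉ (here refl) })))
  intrude t x∉ x∉Q | via-open (S-Par-R u _) _ _ =
    contradiction (step-fa u (there (here refl))) x∉Q

  module _ {x : Name} {P Q : Process} (x∉ : x ∉ fn Q) where

    private
      α-par : ∀ {w} → w ∉ fn P → w ∉ fn Q →
              ν[ w ] (ren (swap x w) P ∣ Q) ≡ ν[ x ] (P ∣ Q)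
      α-par {w} w∉P w∉Q =
        trans (cong (λ S → ν[ w ] (ren (swap x w) P ∣ S)) (sym (ren-swap-∉ Q x∉ w∉Q)))
          (ν-α (P ∣ Q) ([ w∉P , w∉Q ]′ ∘ ∈-++⁻ (fn P)))

    sim-extrude : Sim ((ν[ x ] P) ∣ Q) (ν[ x ] (P ∣ Q))
    sim-extrude {α} t with fresh (bn α ++ fn P ++ fn Q)
    ... | w , w∉ =
      match-≡ (α-par w∉P w∉Q)
        (extrude (step-≡ (cong (_∣ Q) (sym (ν-α P w∉P))) refl refl t) (w∉ ∘ ∈-++⁺ˡ) w∉Q)
      where
      w∉P = w∉ ∘ ∈-++⁺ʳ (bn α) ∘ ∈-++⁺ˡ
      w∉Q = w∉ ∘ ∈-++⁺ʳ (bn α) ∘ ∈-++⁺ʳ (fn P)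

    sim-intrude : Sim (ν[ x ] (P ∣ Q)) ((ν[ x ] P) ∣ Q)
    sim-intrude {α} t with fresh (bn α ++ fn P ++ fn Q)
    ... | w , w∉ =
      match-≡ (cong (_∣ Q) (ν-α P w∉P))
        (intrude (step-≡ (sym (α-par w∉P w∉Q)) refl refl t) (w∉ ∘ ∈-++⁺ˡ) w∉Q)
      where
      w∉P = w∉ ∘ ∈-++⁺ʳ (bn α) ∘ ∈-++⁺ˡ
      w∉Q = w∉ ∘ ∈-++⁺ʳ (bn α) ∘ ∈-++⁺ʳ (fn P)

  -- Exchange of two restrictions.

  ren-ν : ∀ {σ} → Injective _≡_ _≡_ σ → ∀ {x} P → σ x ≡ x → ren σ (ν[ x ] P) ≡ ν[ x ] ren σ P
  ren-ν {σ} σ-inj {x} P e =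
    cong res (trans (sym (abs-ren-inj σ-inj x P)) (cong (λ y → abs y (ren σ P)) e))

  -- One label extrudes at most one of the two names; the rule that opens it trades places with the
  -- `S-Res` of the other.
  exchange : ∀ {x y P α R} → ν[ x ] ν[ y ] P —[ α ]→ R → x ≢ y → x ∉ bn α → y ∉ bn α →
             Match (ν[ y ] ν[ x ] P) α R
  exchange {x} {y} {P} t x≢y x∉ y∉ with res-inv {x} {ν[ y ] P} t x∉
  ... | via-res t₁ x∉n with res-inv {y} {P} t₁ y∉
  ...   | via-res t₂ y∉n = _ , S-Res (S-Res t₂ x∉n) y∉n , res-swap
  ...   | via-open {z = z} {P′} t₂ y≢a z∉ =
    _ ,
    S-Open′ (S-Res t₂ λ { (here refl) → x∉n (here refl); (there (here e)) → x≢y e }) y≢a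
      (step-bn t (here refl) ∘ proj₁ (fn-≅ (res-swap {y} {x} {P}))) ,
    ≅-reflexive (sym (ren-ν (swap-injective y z) P′
      (swap-other (≢-sym x≢y) (λ { refl → x∉ (here refl) }))))
  exchange {x} {y} {P} t x≢y x∉ y∉ | via-open {z = z} t₁ x≢a z∉
    with via-res {P′ = P′} t₂ y∉n ← res-inv {y} {P} t₁ (λ ()) =
    _ ,
    S-Res (S-Open′ t₂ x≢a
            (λ m → z∉ (proj₁ (fn-≅ (res-swap {y} {x} {P}))
                        (fn-abs⁺ (ν[ x ] P) m (λ { refl → y∉ (here refl) })))))
      (λ { (here refl) → y∉n (here refl); (there m) → y∉ m }) ,
    ≅-reflexive (ren-ν (swap-injective x z) P′ (swap-other x≢y (λ { refl → y∉ (here refl) })))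

  -- Both nestings are renamed with one common body, as the step is taken in one order and answered
  -- in the other.
  ν-α² : ∀ {x y w v} P → x ≢ y → w ≢ y → w ∉ fn P → v ∉ fn (ren (swap x w) P) → w ≢ v →
         (ν[ w ] ν[ v ] ren (swap y v) (ren (swap x w) P) ≡ ν[ x ] ν[ y ] P)
         × (ν[ v ] ν[ w ] ren (swap y v) (ren (swap x w) P) ≡ ν[ y ] ν[ x ] P)
  ν-α² {x} {y} {w} {v} P x≢y w≢y w∉ v∉ w≢v =
    trans (cong (λ S → ν[ w ] S) (trans (ν-α P₁ v∉)
            (sym (ren-ν (swap-injective x w) P (swap-other x≢y w≢y)))))
          (ν-α (ν[ y ] P) (w∉ ∘ proj₁ ∘ fn-abs⁻ P)) ,
    trans (cong (λ S → ν[ v ] S)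
            (sym (ren-ν (swap-injective y v) P₁ (swap-other (≢-sym w≢y) (≢-sym w≢v)))))
          (trans (ν-α (ν[ w ] P₁) (v∉ ∘ proj₁ ∘ fn-abs⁻ P₁))
                 (cong (λ S → ν[ y ] S) (ν-α P w∉)))
    where
    P₁ = ren (swap x w) P

  sim-exchange : ∀ {x y P} → Sim (ν[ x ] ν[ y ] P) (ν[ y ] ν[ x ] P)
  sim-exchange {x} {y} {P} {α} t with x ≟ y
  ... | yes refl = _ , t , ≅-refl
  ... | no x≢y with fresh (y ∷ bn α ++ fn P)
  ...   | w , w∉ with fresh (w ∷ bn α ++ fn (ren (swap x w) P))
  ...     | v , v∉
    with e , e′ ← ν-α² P x≢y (∉⇒≢ w∉) (w∉ ∘ there ∘ ∈-++⁺ʳ (bn α))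
                    (v∉ ∘ there ∘ ∈-++⁺ʳ (bn α)) (≢-sym (∉⇒≢ v∉)) =
    match-≡ e′ (exchange (step-≡ (sym e) refl refl t) (≢-sym (∉⇒≢ v∉))
                 (w∉ ∘ there ∘ ∈-++⁺ˡ) (v∉ ∘ there ∘ ∈-++⁺ˡ))

  harmony : ∀ {P Q} → P ≅ Q → Sim P Q × Sim Q P
  harmony ≅-refl = (λ t → _ , t , ≅-refl) , (λ t → _ , t , ≅-refl)
  harmony (≅-sym p) with f , g ← harmony p = g , f
  harmony (≅-trans {P} {Q} {R} p q) with f , g ← harmony p | h , k ← harmony q =
    sim-trans {P} {Q} {R} f h , sim-trans {R} {Q} {P} k g
  harmony (in-cong p)  = sim-in p , sim-in (≅-sym p)
  harmony (out-cong p) = sim-out p , sim-out (≅-sym p)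
  harmony (par-cong p q) with f , g ← harmony p | h , k ← harmony q =
    sim-par p q f h , sim-par (≅-sym p) (≅-sym q) g k
  harmony (res-cong p) with f , g ← harmony p = sim-res p f , sim-res (≅-sym p) g
  harmony (rep-cong p) with f , g ← harmony p = sim-rep p f , sim-rep (≅-sym p) g
  harmony par-assoc             = sim-assoc , sim-assoc⁻¹
  harmony par-unit              = sim-unit , sim-unit⁻¹
  harmony par-comm              = sim-comm , sim-comm
  harmony (res-nil {x})         = sim-nil {x} , sim-nil⁻¹ {x}
  harmony (res-par x∉)          = sim-extrude x∉ , sim-intrude x∉
  harmony (res-swap {x} {y} {P}) = sim-exchange {x} {y} {P} , sim-exchange {y} {x} {P}
  harmony rep-unfold            = sim-unfold , sim-unfold⁻¹

-- Strong barbed similarity: preorder, prefixes, restriction, congruence.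

module BarbedSimilarity (𝒩 : Names) where

  open π-Calculus 𝒩
  open Renaming 𝒩
  open Transitions 𝒩
  open Congruence 𝒩
  open Harmony 𝒩

  open IsStrongBarbedSimulation

  ≤B-reflexive : ∀ {P Q} → P ≡ Q → P ≤B Q
  ≤B-reflexive e = _≡_ , isSim , e
    where
    isSim : IsStrongBarbedSimulation _≡_
    isSim .barb-in refl x b  = b
    isSim .barb-out refl x b = b
    isSim .step refl t       = _ , t , refl

  ≤B-trans : ∀ {P Q R} → P ≤B Q → Q ≤B R → P ≤B R
  ≤B-trans {Q = Q} (ℛ , r , p) (𝒮 , s , q) = ℛ ⨾ 𝒮 , isSim , Q , p , q
    where
    _⨾_ : Rel Process 0ℓ → Rel Process 0ℓ → Rel Process 0ℓ
    (ℛ ⨾ 𝒮) P R = ∃[ Q ] (ℛ P Q × 𝒮 Q R)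

    isSim : IsStrongBarbedSimulation (ℛ ⨾ 𝒮)
    isSim .barb-in (_ , p , q) x  = barb-in s q x ∘ barb-in r p x
    isSim .barb-out (_ , p , q) x = barb-out s q x ∘ barb-out r p x
    isSim .step (_ , p , q) t
      with _ , t₁ , p′ ← step r p t
      with _ , t₂ , q′ ← step s q t₁ = _ , t₂ , _ , p′ , q′

  ≤B-isPreorder : IsPreorder _≡_ _≤B_
  ≤B-isPreorder = record
    { isEquivalence = isEquivalence
    ; reflexive     = ≤B-reflexive
    ; trans         = ≤B-trans
    }

  -- A single pair suffices for prefixed processes: they have no `τ` step, so no derivatives have to
  -- be related.
  data Pair (P Q : Process) : Rel Process 0ℓ where
    pair : Pair P Q P Q

  inp-subject : ∀ {a x z S P′ B} → S —[ a ⦅ z ⦆ ]→ P′ → S ≡ inp (name x) B → a ≡ x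
  inp-subject (S-In _) refl = refl

  -- `y` may equal `x`, which the premise of `S-In` forbids as a bound name; the barb is therefore
  -- exhibited with a fresh `w`.
  in-↓ : ∀ {x y} Q → x ⦅ y ⦆∙ Q ↓ x
  in-↓ {x} {y} Q with fresh (fn (x ⦅ y ⦆∙ Q))
  ... | w , w∉ = w , _ ,
    step-≡ (cong (inp (name x)) e) refl refl
      (S-In (w∉ ∘ subst (λ B → w ∈ fn (inp (name x) B)) e))
    where
    e : abs w (ren (swap y w) Q) ≡ abs y Q
    e = abs-swap y w Q (w∉ ∘ there)

  ≤B-in : ∀ {x y P Q} → x ⦅ y ⦆∙ P ≤B x ⦅ y ⦆∙ Q
  ≤B-in {x} {y} {P} {Q} = Pair _ _ , isSim , pair
    where
    isSim : IsStrongBarbedSimulation (Pair (x ⦅ y ⦆∙ P) (x ⦅ y ⦆∙ Q))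
    isSim .barb-in pair a (_ , _ , t) with refl ← inp-subject t refl = in-↓ Q
    isSim .barb-out pair a (inj₁ (_ , _ , ()))
    isSim .barb-out pair a (inj₂ (_ , _ , ()))
    isSim .step pair ()

  ≤B-out : ∀ {x y P Q} → x ⟨ y ⟩∙ P ≤B x ⟨ y ⟩∙ Q
  ≤B-out {x} {y} {P} {Q} = Pair _ _ , isSim , pair
    where
    isSim : IsStrongBarbedSimulation (Pair (x ⟨ y ⟩∙ P) (x ⟨ y ⟩∙ Q))
    isSim .barb-in pair a (_ , _ , ())
    isSim .barb-out pair a (inj₁ (_ , _ , S-Out)) = inj₁ (_ , _ , S-Out)
    isSim .step pair ()

  data ν-closure (x : Name) (ℛ : Rel Process 0ℓ) : Rel Process 0ℓ where
    ν-pair : ∀ {P Q} → ℛ P Q → ν-closure x ℛ (ν[ x ] P) (ν[ x ] Q)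

  ν-↓⁻ : ∀ {x a P} → ν[ x ] P ↓ a → x ≢ a × P ↓ a
  ν-↓⁻ {x} {a} (_ , _ , t)
    with w , _ , w∉ , t′ , _ ← fresh-in t (x ∷ [])
    with via-res t″ x∉n ← res-inv t′ (∉-singleton (≢-sym (∉⇒≢ w∉))) =
    ∉⇒≢ x∉n , _ , _ , t″

  ν-↓⁺ : ∀ {x a P} → x ≢ a → P ↓ a → ν[ x ] P ↓ a
  ν-↓⁺ {x} x≢a (_ , _ , t) with w , _ , w∉ , t′ , _ ← fresh-in t (x ∷ []) =
    _ , _ , S-Res′ t′ (∉-singleton x≢a) (∉-singleton (≢-sym (∉⇒≢ w∉)))

  ν-↓̄⁻ : ∀ {x a P} → ν[ x ] P ↓̄ a → x ≢ a × P ↓̄ a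
  ν-↓̄⁻ (inj₁ (_ , _ , t)) with via-res t′ x∉n ← res-inv t (λ ()) =
    ∉⇒≢ x∉n , inj₁ (_ , _ , t′)
  ν-↓̄⁻ {x} (inj₂ (_ , _ , t))
    with w , _ , w∉ , t′ ← fresh-bout t (x ∷ [])
    with res-inv t′ (∉-singleton (≢-sym (∉⇒≢ w∉)))
  ... | via-res t″ x∉n     = ∉⇒≢ x∉n , inj₂ (_ , _ , t″)
  ... | via-open t″ x≢a _ = x≢a , inj₁ (_ , _ , t″)

  ν-↓̄⁺ : ∀ {x a P} → x ≢ a → P ↓̄ a → ν[ x ] P ↓̄ a
  ν-↓̄⁺ {x} x≢a (inj₁ (y , _ , t)) with x ≟ y
  -- Sending the restricted name turns a free output into a bound one on the same channel, and an
  -- output barb admits both.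
  ... | yes refl = inj₂ (_ , _ , S-Open t x≢a)
  ... | no x≢y   =
    inj₁ (_ , _ , S-Res t λ { (here e) → x≢a e ; (there (here e)) → x≢y e })
  ν-↓̄⁺ {x} x≢a (inj₂ (_ , _ , t)) with w , _ , w∉ , t′ ← fresh-bout t (x ∷ []) =
    inj₂ (_ , _ , S-Res′ t′ (∉-singleton x≢a) (∉-singleton (≢-sym (∉⇒≢ w∉))))

  ≤B-ν : ∀ {x P Q} → P ≤B Q → ν[ x ] P ≤B ν[ x ] Q
  ≤B-ν {x} (ℛ , r , p) = ν-closure x ℛ , isSim r , ν-pair p
    where
    isSim : ∀ {ℛ} → IsStrongBarbedSimulation ℛ → IsStrongBarbedSimulation (ν-closure x ℛ)
    isSim r .barb-in (ν-pair p) a b with x≢a , b′ ← ν-↓⁻ b = ν-↓⁺ x≢a (barb-in r p a b′)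
    isSim r .barb-out (ν-pair p) a b with x≢a , b′ ← ν-↓̄⁻ b = ν-↓̄⁺ x≢a (barb-out r p a b′)
    isSim r .step (ν-pair p) t
      -- `τ` binds nothing and never arises by opening, so `x` stays restricted in the derivative.
      with via-res t′ _ ← res-inv t (λ ())
      with _ , u , q ← step r p t′ = _ , S-Res u (λ ()) , ν-pair q

  ≅⇒≤B : ∀ {P Q} → P ≅ Q → P ≤B Q
  ≅⇒≤B p = _≅_ , isSim , p
    where
    isSim : IsStrongBarbedSimulation _≅_
    isSim .barb-in p x (_ , _ , t) with _ , u , _ ← proj₁ (harmony p) t = _ , _ , u
    isSim .barb-out p x (inj₁ (_ , _ , t)) with _ , u , _ ← proj₁ (harmony p) t =
      inj₁ (_ , _ , u)
    isSim .barb-out p x (inj₂ (_ , _ , t)) with _ , u , _ ← proj₁ (harmony p) t =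
      inj₂ (_ , _ , u)
    isSim .step p t = proj₁ (harmony p) t

lemma3p3 : (𝒩 : Names) → let open π-Calculus 𝒩 in
    IsPreorder _≡_ _≤B_
    × (∀ {P Q} → P ≤B Q → ∀ x y →
    (x ⦅ y ⦆∙ P ≤B x ⦅ y ⦆∙ Q)
    × (x ⟨ y ⟩∙ P ≤B x ⟨ y ⟩∙ Q)
    × (ν[ x ] P ≤B ν[ x ] Q))
    × (∀ {P Q} → P ≅ Q → P ≤B Q)
lemma3p3 𝒩 = ≤B-isPreorder , (λ p x y → ≤B-in , ≤B-out , ≤B-ν p) , ≅⇒≤B
  where open BarbedSimilarity 𝒩
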